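{- $(\mathbf{Ren},\diamond,\mathbb{A},[-,-]_\diamond)$ is a right closed monoidal category: the substitution tensor $\diamond$ with unit $\mathbb{A}$ is a monoidal structure on the category $\mathbf{Ren}$ of renaming sets, and $\mathbf{Ren}(X\diamond Y,Z)\cong\mathbf{Ren}(X,[Y,Z]_\diamond)$ naturally.
   Context: $\mathbb{A}$ is a countably infinite set of names. A renaming is a map $\rho\colon\mathbb{A}\to\mathbb{A}$ with $\rho a=a$ for all but finitely many $a$; $\mathrm{Ren}\,\mathbb{A}$ is the monoid of renamings. A (nominal) renaming set is a set $X$ with a monoid action $\mathrm{Ren}\,\mathbb{A}\times X\to X$ such that every $x\in X$ has a finite support, i.e. a finite $A\subseteq\mathbb{A}$ such that $\rho|_A=\mathrm{id}_A$ implies $\rho\cdot x=x$; then $x$ has a least finite support $\operatorname{supp}x$. $\mathbf{Ren}$ is the category of renaming sets and equivariant maps. $\mathbb{A}$ is a renaming set via $\rho\cdot a=\rho(a)$. The substitution tensor on $\mathbf{Ren}$ is the extension of the action $A\triangleleft X=X^A$ ($A$ a finite set) along $\psi\colon\mathbb{F}^{\mathrm{op}}\to\mathbf{Ren}$, $\psi A=\mathbb{A}^A$ (with $\mathbb{F}$ the category of finite sets and functions), i.e. $X\diamond Y=\int^{A\in\mathbb{F}}\mathbf{Ren}(\mathbb{A}^A,X)\cdot Y^A$ (with $\cdot$ the copower), explicitly $$X\diamond Y=\{(x,\gamma)\mid x\in X,\ \gamma\in Y^{\operatorname{supp}x}\}/\sim,$$ where $\sim$ is generated by $(\sigma\cdot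 x,\gamma|_{\operatorname{supp}(\sigma\cdot x)})\sim(x,\gamma\sigma)$ for $\sigma\in\mathrm{Ren}\,\mathbb{A}$, $x\in X$ and $\gamma\in Y^{\sigma[\operatorname{supp}x]}$ (here $\gamma\sigma$ is $a\mapsto\gamma(\sigma(a))$ on $\operatorname{supp}x$). Writing $x[\gamma]$ for the class of $(x,\gamma)$, the action is $\sigma\cdot x[\gamma]=x[\sigma\cdot\gamma]$ with $\sigma\cdot\gamma$ pointwise, and $\operatorname{supp}x[\gamma]=\bigcup_{a\in\operatorname{supp}x}\operatorname{supp}\gamma(a)$. A map $f\colon Y^{\mathbb{A}}\to Z$ is finitely reducible if there is a finite $A\subseteq\mathbb{A}$ such that $f=g\cdot p_A$ for some $g\colon Y^{A}\to Z$, where $p_A\colon Y^{\mathbb{A}}\to Y^A$ is restriction. The internal hom is $$[Y,Z]_\diamond=\{f\colon Y^{\mathbb{A}}\to Z\mid f\text{ is }\mathrm{Ren}\,\mathbb{A}\text{ -equivariant and finitely reducible}\},$$ where $Y^{\mathbb{A}}$ carries the pointwise action, and with action $(\sigma\cdot f)(\gamma)=f(\gamma\sigma)$.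
   Formalization: The bijection Ren(X◇Y,Z) ≅ Ren(X,[Y,Z]) is claimed only for inhabited Y, as it fails for Y empty: with X = 1 and Y = Z = ∅, Ren(1◇∅,∅) is empty but Ren(1,[∅,∅]) is a point. The monoidal structure and the natural currying map are given for all renaming sets. -}

module Defs where

open import Data.Empty.Polymorphic using (⊥; ⊥-elim)
open import Data.Fin.Base using (Fin)
open import Data.List.Base using (List; []; _∷_; _++_; map; concat; tabulate)
open import Data.List.Membership.Propositional using (_∈_; _∉_)
open import Data.List.Membership.Propositional.Properties
  using (∈-map⁺; ∈-++⁺ˡ; ∈-++⁺ʳ; ∈-concat⁺′; ∈-tabulate⁺)
open import Data.List.Relation.Unary.Any using (here)
open import Data.Nat.Base using (ℕ)
open import Data.Product.Base using (Σ; ∃; _×_; _,_; proj₁; proj₂)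
open import Data.Product.Relation.Binary.Pointwise.NonDependent using (×-isEquivalence)
open import Data.Unit.Polymorphic using (⊤; tt)
open import Function.Base using (_∘′_)
open import Function.Bundles using (Func)
open import Function.Construct.Composition using () renaming (function to compose)
open import Function.Construct.Identity using () renaming (function to identity)
open import Function.Definitions using (Bijective)
open import Function.Relation.Binary.Setoid.Equality using (_⇨_)
open import Level using (Level; _⊔_) renaming (suc to lsuc)
open import Relation.Binary.Bundles using (Setoid)
open import Relation.Binary.Structures using (IsEquivalence)
import Relation.Binary.Construct.Closure.Equivalence as EqC
import Relation.Binary.Construct.Closure.ReflexiveTransitive as Star
import Relation.Binary.Construct.Closure.Symmetric as Sym
import Relation.Binary.Construct.On as On
open import Relation.Binary.PropositionalEquality.Core as ≡ using (_≡_)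
import Relation.Binary.PropositionalEquality.Properties as ≡
open import Relation.Nullary.Negation.Core using (¬_)

record Category (o ℓ e : Level) : Set (lsuc (o ⊔ ℓ ⊔ e)) where
  infix  4 _≈_ _⇒_
  infixr 9 _∘_
  field
    Obj       : Set o
    _⇒_       : Obj → Obj → Set ℓ
    _≈_       : ∀ {X Y} → X ⇒ Y → X ⇒ Y → Set e
    id        : ∀ {X} → X ⇒ X
    _∘_       : ∀ {X Y Z} → Y ⇒ Z → X ⇒ Y → X ⇒ Z
    equiv     : ∀ {X Y} → IsEquivalence (_≈_ {X} {Y})
    ∘-cong    : ∀ {X Y Z} {f f′ : Y ⇒ Z} {g g′ : X ⇒ Y} → f ≈ f′ → g ≈ g′ → f ∘ g ≈ f′ ∘ g′
    identityˡ : ∀ {X Y} {f : X ⇒ Y} → id ∘ f ≈ f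
    identityʳ : ∀ {X Y} {f : X ⇒ Y} → f ∘ id ≈ f
    assoc     : ∀ {W X Y Z} {f : Y ⇒ Z} {g : X ⇒ Y} {h : W ⇒ X} → (f ∘ g) ∘ h ≈ f ∘ (g ∘ h)

  Hom : Obj → Obj → Setoid ℓ e
  Hom X Y = record { isEquivalence = equiv {X} {Y} }

_ᵒᵖ : ∀ {o ℓ e} → Category o ℓ e → Category o ℓ e
C ᵒᵖ = record
  { Obj       = Obj
  ; _⇒_       = λ X Y → Y ⇒ X
  ; _≈_       = _≈_
  ; id        = id
  ; _∘_       = λ f g → g ∘ f
  ; equiv     = equiv
  ; ∘-cong    = λ p q → ∘-cong q p
  ; identityˡ = identityʳ
  ; identityʳ = identityˡ
  ; assoc     = IsEquivalence.sym equiv assoc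
  } where open Category C

infixr 2 _×ᶜ_
_×ᶜ_ : ∀ {o ℓ e o′ ℓ′ e′} → Category o ℓ e → Category o′ ℓ′ e′ →
       Category (o ⊔ o′) (ℓ ⊔ ℓ′) (e ⊔ e′)
C ×ᶜ D = record
  { Obj       = C.Obj × D.Obj
  ; _⇒_       = λ (X , X′) (Y , Y′) → (X C.⇒ Y) × (X′ D.⇒ Y′)
  ; _≈_       = λ (f , f′) (g , g′) → (f C.≈ g) × (f′ D.≈ g′)
  ; id        = C.id , D.id
  ; _∘_       = λ (f , f′) (g , g′) → f C.∘ g , f′ D.∘ g′
  ; equiv     = ×-isEquivalence C.equiv D.equiv
  ; ∘-cong    = λ (p , p′) (q , q′) → C.∘-cong p q , D.∘-cong p′ q′
  ; identityˡ = C.identityˡ , D.identityˡ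
  ; identityʳ = C.identityʳ , D.identityʳ
  ; assoc     = C.assoc , D.assoc
  } where module C = Category C
          module D = Category D

record Functor {o ℓ e o′ ℓ′ e′} (C : Category o ℓ e) (D : Category o′ ℓ′ e′) :
               Set (o ⊔ ℓ ⊔ e ⊔ o′ ⊔ ℓ′ ⊔ e′) where
  private module C = Category C
          module D = Category D
  field
    F₀     : C.Obj → D.Obj
    F₁     : ∀ {X Y} → X C.⇒ Y → F₀ X D.⇒ F₀ Y
    F-cong : ∀ {X Y} {f g : X C.⇒ Y} → f C.≈ g → F₁ f D.≈ F₁ g
    F-id   : ∀ {X} → F₁ (C.id {X}) D.≈ D.id
    F-∘    : ∀ {X Y Z} {f : Y C.⇒ Z} {g : X C.⇒ Y} → F₁ (f C.∘ g) D.≈ F₁ f D.∘ F₁ g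

module _ {o ℓ e} (C : Category o ℓ e) where
  open Category C

  infix 4 _≅_
  record _≅_ (X Y : Obj) : Set (ℓ ⊔ e) where
    field
      to   : X ⇒ Y
      from : Y ⇒ X
      isoˡ : from ∘ to ≈ id
      isoʳ : to ∘ from ≈ id

  record MonoidalStructure (⊗ : Functor (C ×ᶜ C) C) (I : Obj) : Set (o ⊔ ℓ ⊔ e) where
    infixr 10 _⊗₀_ _⊗₁_
    _⊗₀_ : Obj → Obj → Obj
    X ⊗₀ Y = Functor.F₀ ⊗ (X , Y)

    _⊗₁_ : ∀ {X X′ Y Y′} → X ⇒ X′ → Y ⇒ Y′ → X ⊗₀ Y ⇒ X′ ⊗₀ Y′
    f ⊗₁ g = Functor.F₁ ⊗ (f , g)

    field
      associator : ∀ X Y Z → (X ⊗₀ Y) ⊗₀ Z ≅ X ⊗₀ (Y ⊗₀ Z)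
      unitorˡ    : ∀ X → I ⊗₀ X ≅ X
      unitorʳ    : ∀ X → X ⊗₀ I ≅ X

    α : ∀ X Y Z → (X ⊗₀ Y) ⊗₀ Z ⇒ X ⊗₀ (Y ⊗₀ Z)
    α X Y Z = _≅_.to (associator X Y Z)

    λ⊗ : ∀ X → I ⊗₀ X ⇒ X
    λ⊗ X = _≅_.to (unitorˡ X)

    ρ⊗ : ∀ X → X ⊗₀ I ⇒ X
    ρ⊗ X = _≅_.to (unitorʳ X)

    field
      α-natural : ∀ {X X′ Y Y′ Z Z′} (f : X ⇒ X′) (g : Y ⇒ Y′) (h : Z ⇒ Z′) →
                  α X′ Y′ Z′ ∘ ((f ⊗₁ g) ⊗₁ h) ≈ (f ⊗₁ (g ⊗₁ h)) ∘ α X Y Z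
      λ-natural : ∀ {X X′} (f : X ⇒ X′) → λ⊗ X′ ∘ (id ⊗₁ f) ≈ f ∘ λ⊗ X
      ρ-natural : ∀ {X X′} (f : X ⇒ X′) → ρ⊗ X′ ∘ (f ⊗₁ id) ≈ f ∘ ρ⊗ X
      triangle  : ∀ X Y → (id {X} ⊗₁ λ⊗ Y) ∘ α X I Y ≈ ρ⊗ X ⊗₁ id {Y}
      pentagon  : ∀ W X Y Z →
                  (id {W} ⊗₁ α X Y Z) ∘ (α W (X ⊗₀ Y) Z ∘ (α W X Y ⊗₁ id {Z}))
                  ≈ α W X (Y ⊗₀ Z) ∘ α (W ⊗₀ X) Y Z

  -- A family Hom (X ⊗ Y) Z → Hom X [ Y , Z ] natural in all three arguments
  -- that is invertible at every Y satisfying P.  When P holds everywhere this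
  -- is right closedness with internal hom [_,_].
  record RightClosedAt {p} (⊗ : Functor (C ×ᶜ C) C) (hom : Functor (C ᵒᵖ ×ᶜ C) C)
                       (P : Obj → Set p) : Set (o ⊔ ℓ ⊔ e ⊔ p) where
    private
      infixr 10 _⊗₀_
      _⊗₀_ : Obj → Obj → Obj
      X ⊗₀ Y = Functor.F₀ ⊗ (X , Y)

      [_,_] : Obj → Obj → Obj
      [ Y , Z ] = Functor.F₀ hom (Y , Z)

    field
      curry : ∀ X Y Z → Func (Hom (X ⊗₀ Y) Z) (Hom X [ Y , Z ])

    Λ : ∀ {X Y Z} → X ⊗₀ Y ⇒ Z → X ⇒ [ Y , Z ]
    Λ {X} {Y} {Z} = Func.to (curry X Y Z)

    field
      Λ-natural   : ∀ {X X′ Y Y′ Z Z′} (f : X′ ⇒ X) (g : Y′ ⇒ Y) (k : Z ⇒ Z′) (h : X ⊗₀ Y ⇒ Z) →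
                    Λ (k ∘ (h ∘ Functor.F₁ ⊗ (f , g))) ≈ Functor.F₁ hom (g , k) ∘ (Λ h ∘ f)
      Λ-bijective : ∀ X Y Z → P Y → Bijective _≈_ _≈_ (Λ {X} {Y} {Z})

module Renamings {u : Level} (𝔸 : Set u) where

  -- Renamings are compared by pointwise equality of the underlying maps, which
  -- the action of a renaming set has to respect (field ·-cong below).
  record Renaming : Set u where
    field
      fun    : 𝔸 → 𝔸
      finite : ∃ λ (A : List 𝔸) → ∀ a → a ∉ A → fun a ≡ a

  open Renaming public using () renaming (fun to ⟦_⟧)

  idᵣ : Renaming
  idᵣ = record { fun = λ a → a ; finite = [] , λ _ _ → ≡.refl }

  infixr 9 _∘ᵣ_
  _∘ᵣ_ : Renaming → Renaming → Renaming
  σ ∘ᵣ τ = record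
    { fun    = λ a → ⟦ σ ⟧ (⟦ τ ⟧ a)
    ; finite = let (A , σ-fix) = Renaming.finite σ
                   (B , τ-fix) = Renaming.finite τ
               in A ++ B , λ a a∉ →
                  ≡.trans (≡.cong ⟦ σ ⟧ (τ-fix a (λ a∈B → a∉ (∈-++⁺ʳ A a∈B))))
                          (σ-fix a (λ a∈A → a∉ (∈-++⁺ˡ a∈A)))
    }

  -- Finite subsets of 𝔸 are given by lists; order and repetitions are immaterial.
  record RenamingSet : Set (lsuc u) where
    infixr 8 _·_
    field
      setoid : Setoid u u
    open Setoid setoid public
    field
      _·_    : Renaming → Carrier → Carrier
      ·-cong : ∀ {σ τ x y} → (∀ a → ⟦ σ ⟧ a ≡ ⟦ τ ⟧ a) → x ≈ y → σ · x ≈ τ · y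
      ·-id   : ∀ x → idᵣ · x ≈ x
      ·-∘    : ∀ σ τ x → (σ ∘ᵣ τ) · x ≈ σ · (τ · x)

    Supports : List 𝔸 → Carrier → Set u
    Supports A x = ∀ σ → (∀ {a} → a ∈ A → ⟦ σ ⟧ a ≡ a) → σ · x ≈ x

    field
      finitely-supported : ∀ x → ∃ λ A → Supports A x

  ∣_∣ : RenamingSet → Set u
  ∣_∣ = RenamingSet.Carrier

  record Equivariant (X Y : RenamingSet) : Set u where
    private module X = RenamingSet X
            module Y = RenamingSet Y
    field
      func        : Func X.setoid Y.setoid
    open Func func public
    field
      equivariant : ∀ σ x → to (σ X.· x) Y.≈ σ Y.· to x

  open Equivariant using (func; to; equivariant)

  infix 4 _≈ₑ_
  _≈ₑ_ : ∀ {X Y} → Equivariant X Y → Equivariant X Y → Set u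
  _≈ₑ_ {Y = Y} f g = ∀ x → RenamingSet._≈_ Y (to f x) (to g x)

  Ren : Category (lsuc u) u u
  Ren = record
    { Obj       = RenamingSet
    ; _⇒_       = Equivariant
    ; _≈_       = _≈ₑ_
    ; id        = λ {X} → record
      { func        = identity (RenamingSet.setoid X)
      ; equivariant = λ _ _ → RenamingSet.refl X
      }
    ; _∘_       = λ {X} {Y} {Z} g f → record
      { func        = compose (func f) (func g)
      ; equivariant = λ σ x → RenamingSet.trans Z
          (Equivariant.cong g (equivariant f σ x)) (equivariant g σ (to f x))
      }
    ; equiv     = λ {X} {Y} →
                  On.isEquivalence func (Setoid.isEquivalence (RenamingSet.setoid X ⇨ RenamingSet.setoid Y))
    ; ∘-cong    = λ {X} {Y} {Z} {f} {f′} {g} {g′} p q x →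
                  RenamingSet.trans Z (Equivariant.cong f (q x)) (p (to g′ x))
    ; identityˡ = λ {X} {Y} _ → RenamingSet.refl Y
    ; identityʳ = λ {X} {Y} _ → RenamingSet.refl Y
    ; assoc     = λ {W} {X} {Y} {Z} _ → RenamingSet.refl Z
    }

  open Category Ren using (_∘_)

  Names : RenamingSet
  Names = record
    { setoid = ≡.setoid 𝔸
    ; _·_    = ⟦_⟧
    ; ·-cong = λ {σ} σ≗τ a≡b → ≡.trans (≡.cong ⟦ σ ⟧ a≡b) (σ≗τ _)
    ; ·-id   = λ _ → ≡.refl
    ; ·-∘    = λ _ _ _ → ≡.refl
    ; finitely-supported = λ a → a ∷ [] , λ σ σ-fix → σ-fix (here ≡.refl)
    }

  -- Yⁿ with the pointwise action.  The finite set Fin n plays the role of A in Y^A.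
  infixl 10 _^_
  _^_ : RenamingSet → ℕ → RenamingSet
  Y ^ n = record
    { setoid = record
      { Carrier       = Fin n → ∣ Y ∣
      ; _≈_           = λ γ δ → ∀ i → γ i ≈ δ i
      ; isEquivalence = record
        { refl  = λ _ → refl
        ; sym   = λ p i → sym (p i)
        ; trans = λ p q i → trans (p i) (q i)
        }
      }
    ; _·_    = λ σ γ i → σ · γ i
    ; ·-cong = λ σ≗τ p i → ·-cong σ≗τ (p i)
    ; ·-id   = λ γ i → ·-id (γ i)
    ; ·-∘    = λ σ τ γ i → ·-∘ σ τ (γ i)
    ; finitely-supported = λ γ →
        let supp i = proj₁ (finitely-supported (γ i))
        in concat (tabulate supp) , λ σ σ-fix i →
           proj₂ (finitely-supported (γ i)) σ
             (λ a∈ → σ-fix (∈-concat⁺′ a∈ (∈-tabulate⁺ {f = supp} i)))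
    } where open RenamingSet Y

  ψ : ∀ {m n} → (Fin m → Fin n) → Equivariant (Names ^ n) (Names ^ m)
  ψ f = record
    { func        = record { to = λ a → a ∘′ f ; cong = λ p i → p (f i) }
    ; equivariant = λ _ _ _ → ≡.refl
    }

  -- X ◇ Y is the substitution tensor, i.e. the coend ∫ⁿ Ren(𝔸ⁿ, X) · Yⁿ over the
  -- skeleton of 𝔽 with objects the sets Fin n.  Colimits in Ren are formed
  -- on underlying sets and the copower S · Z is S × Z with σ · (s , z) =
  -- (s , σ · z), so it is the quotient of the disjoint union of the sets
  -- Ren(𝔸ⁿ, X) × Yⁿ by (φ ∘ ψ f , γ) ~ (φ , γ ∘ f).
  -- For x supported by distinct names a₁, …, aₙ and φ the equivariant map with
  -- φ (a₁, …, aₙ) = x, the class of (φ , γ) is the substitution x[γ].  (Least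
  -- supports are not computable in general, so ◇ is not presented through them.)

  module _ (X Y : RenamingSet) where
    private module Y = RenamingSet Y

    Term : Set u
    Term = Σ ℕ λ n → Equivariant (Names ^ n) X × ∣ Y ^ n ∣

    infix 4 _~_
    -- The equations up to ≈ make ~ contain the equalities of the hom-setoid
    -- and of Yⁿ (take f the identity).
    data _~_ : Term → Term → Set u where
      glue : ∀ {m n} (f : Fin m → Fin n)
             {φ : Equivariant (Names ^ m) X} {φ′ : Equivariant (Names ^ n) X}
             {γ : ∣ Y ^ n ∣} {γ′ : ∣ Y ^ m ∣} →
             φ′ ≈ₑ φ ∘ ψ f → (∀ i → γ′ i Y.≈ γ (f i)) →
             (n , φ′ , γ) ~ (m , φ , γ′)

    private
      ~-eq : ∀ {n φ} {γ δ : ∣ Y ^ n ∣} → (∀ i → γ i Y.≈ δ i) →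
             EqC.EqClosure _~_ (n , φ , γ) (n , φ , δ)
      ~-eq p = Sym.fwd (glue (λ i → i) (λ _ → RenamingSet.refl X) (λ i → Y.sym (p i))) Star.◅ Star.ε

    infixr 9 _◇_
    _◇_ : RenamingSet
    _◇_ = record
      { setoid = EqC.setoid _~_
      ; _·_    = λ σ → act σ
      ; ·-cong = λ {σ} {τ} {s} σ≗τ s≈t →
          EqC.transitive _~_ (~-eq λ i → Y.·-cong σ≗τ Y.refl) (act-cong τ s≈t)
      ; ·-id   = λ _ → ~-eq λ i → Y.·-id _
      ; ·-∘    = λ σ τ _ → ~-eq λ i → Y.·-∘ σ τ _
      ; finitely-supported = λ (n , φ , γ) →
          let (A , A-supports) = RenamingSet.finitely-supported (Y ^ n) γ
          in A , λ σ σ-fix → ~-eq (A-supports σ σ-fix)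
      } where
      act : Renaming → Term → Term
      act σ (n , φ , γ) = n , φ , λ i → σ Y.· γ i

      act-cong : ∀ σ {s t} → EqC.EqClosure _~_ s t → EqC.EqClosure _~_ (act σ s) (act σ t)
      act-cong σ = EqC.gmap (act σ)
        λ { (glue f p q) → glue f p (λ i → Y.·-cong (λ _ → ≡.refl) (q i)) }

  ◇-functor : Functor (Ren ×ᶜ Ren) Ren
  ◇-functor = record
    { F₀     = λ (X , Y) → X ◇ Y
    ; F₁     = λ {(X , Y)} {(X′ , Y′)} (f , g) → record
      { func        = record
        { to   = λ (n , φ , γ) → n , f ∘ φ , to g ∘′ γ
        ; cong = EqC.gmap _ λ { (glue h p q) →
            glue h (λ a → Equivariant.cong f (p a)) (λ i → Equivariant.cong g (q i)) }
        }
      ; equivariant = λ σ (n , φ , γ) → eq X′ Y′ (λ _ → RenamingSet.refl X′) (λ i → equivariant g σ (γ i))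
      }
    ; F-cong = λ {(X , Y)} {(X′ , Y′)} (p , q) (n , φ , γ) → eq X′ Y′ (λ a → p (to φ a)) (λ i → q (γ i))
    ; F-id   = λ {(X , Y)} _ → eq X Y (λ _ → RenamingSet.refl X) (λ _ → RenamingSet.refl Y)
    ; F-∘    = λ {_} {_} {(X , Y)} _ → eq X Y (λ _ → RenamingSet.refl X) (λ _ → RenamingSet.refl Y)
    } where
    eq : ∀ X Y {n φ φ′} {γ γ′ : ∣ Y ^ n ∣} →
         φ ≈ₑ φ′ → (∀ i → RenamingSet._≈_ Y (γ i) (γ′ i)) →
         RenamingSet._≈_ (X ◇ Y) (n , φ , γ) (n , φ′ , γ′)
    eq X Y p q = Sym.fwd (glue (λ i → i) p (λ i → RenamingSet.sym Y (q i))) Star.◅ Star.ε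

  Elements : List 𝔸 → Setoid u u
  Elements A = On.setoid (≡.setoid 𝔸) (proj₁ {B = _∈ A})

  module _ (Y Z : RenamingSet) where
    private module Y = RenamingSet Y
            module Z = RenamingSet Z

    -- Y^𝔸 for the whole set of names; here γ ranges over all maps, and the
    -- pointwise action on it need not be finitely supported.
    Valuations : Setoid u u
    Valuations = record
      { Carrier       = 𝔸 → Y.Carrier
      ; _≈_           = λ γ δ → ∀ a → γ a Y.≈ δ a
      ; isEquivalence = record
        { refl  = λ _ → Y.refl
        ; sym   = λ p a → Y.sym (p a)
        ; trans = λ p q a → Y.trans (p a) (q a)
        }
      }

    restrict : (A : List 𝔸) → (𝔸 → Y.Carrier) → Func (Elements A) Y.setoid
    restrict A γ = record { to = λ (a , _) → γ a ; cong = λ { ≡.refl → Y.refl } }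

    FinitelyReducible : Func Valuations Z.setoid → Set u
    FinitelyReducible f = ∃ λ (A : List 𝔸) → Σ (Func (Elements A ⇨ Y.setoid) Z.setoid) λ g →
      ∀ γ → Func.to f γ Z.≈ Func.to g (restrict A γ)

    record InternalMap : Set u where
      field
        fun             : Func Valuations Z.setoid
        fun-equivariant : ∀ σ γ → Func.to fun (λ a → σ Y.· γ a) Z.≈ σ Z.· Func.to fun γ
        reducible       : FinitelyReducible fun
      open Func fun public using (to; cong)

    open InternalMap using () renaming (to to app)

    [_,_]◇ : RenamingSet
    [_,_]◇ = record
      { setoid = On.setoid (Valuations ⇨ Z.setoid) InternalMap.fun
      ; _·_    = λ σ f → record
        { fun             = record
          { to   = λ γ → app f (γ ∘′ ⟦ σ ⟧)
          ; cong = λ p → InternalMap.cong f (λ a → p (⟦ σ ⟧ a))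
          }
        ; fun-equivariant = λ τ γ → InternalMap.fun-equivariant f τ (γ ∘′ ⟦ σ ⟧)
        ; reducible       = reducible-· σ f
        }
      ; ·-cong = λ {σ} {τ} {f} {f′} σ≗τ f≈f′ γ →
          Z.trans (InternalMap.cong f (λ a → Y.reflexive (≡.cong γ (σ≗τ a)))) (f≈f′ (γ ∘′ ⟦ τ ⟧))
      ; ·-id   = λ _ _ → Z.refl
      ; ·-∘    = λ _ _ _ _ → Z.refl
      ; finitely-supported = λ f →
          let (A , g , f≈g) = InternalMap.reducible f
          in A , λ σ σ-fix γ →
             Z.trans (f≈g (γ ∘′ ⟦ σ ⟧))
               (Z.trans (Func.cong g (λ (a , a∈A) → Y.reflexive (≡.cong γ (σ-fix a∈A))))
                        (Z.sym (f≈g γ)))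
      } where
      reducible-· : ∀ σ f → FinitelyReducible record
        { to   = λ γ → app f (γ ∘′ ⟦ σ ⟧)
        ; cong = λ p → InternalMap.cong f (λ a → p (⟦ σ ⟧ a))
        }
      reducible-· σ f =
        let (A , g , f≈g) = InternalMap.reducible f
        in map ⟦ σ ⟧ A
         , record
           { to   = λ δ → Func.to g record
             { to   = λ (a , a∈A) → Func.to δ (⟦ σ ⟧ a , ∈-map⁺ ⟦ σ ⟧ a∈A)
             ; cong = λ a≡b → Func.cong δ (≡.cong ⟦ σ ⟧ a≡b)
             }
           ; cong = λ p → Func.cong g (λ (a , a∈A) → p (⟦ σ ⟧ a , ∈-map⁺ ⟦ σ ⟧ a∈A))
           }
         , λ γ → Z.trans (f≈g (γ ∘′ ⟦ σ ⟧)) (Func.cong g (λ _ → Y.refl))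

  private
    transport : ∀ {Y Y′ Z Z′} → Equivariant Y′ Y → Equivariant Z Z′ →
                InternalMap Y Z → InternalMap Y′ Z′
    transport {Y} {Y′} {Z} {Z′} g k f = record
      { fun             = record
        { to   = λ γ → to k (F.to (to g ∘′ γ))
        ; cong = λ p → Equivariant.cong k (F.cong (λ a → Equivariant.cong g (p a)))
        }
      ; fun-equivariant = λ σ γ → Z′.trans
          (Equivariant.cong k (Z.trans (F.cong (λ a → equivariant g σ (γ a))) (F.fun-equivariant σ (to g ∘′ γ))))
          (equivariant k σ (F.to (to g ∘′ γ)))
      ; reducible       =
          let (A , r , f≈r) = F.reducible
          in A
           , record
             { to   = λ δ → to k (Func.to r (compose δ (func g)))
             ; cong = λ p → Equivariant.cong k (Func.cong r (λ a → Equivariant.cong g (p a)))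
             }
           , λ γ → Equivariant.cong k (Z.trans (f≈r (to g ∘′ γ)) (Func.cong r (λ _ → Y.refl)))
      }
      where module F = InternalMap f
            module Y = RenamingSet Y
            module Z = RenamingSet Z
            module Z′ = RenamingSet Z′

  hom-functor : Functor (Ren ᵒᵖ ×ᶜ Ren) Ren
  hom-functor = record
    { F₀     = λ (Y , Z) → [ Y , Z ]◇
    ; F₁     = λ {(Y , Z)} {(Y′ , Z′)} (g , k) → record
      { func        = record
        { to   = transport g k
        ; cong = λ p γ → Equivariant.cong k (p (to g ∘′ γ))
        }
      ; equivariant = λ _ _ _ → RenamingSet.refl Z′
      }
    ; F-cong = λ {(Y , Z)} {(Y′ , Z′)} {(g , k)} {(g′ , k′)} (p , q) f γ →
        RenamingSet.trans Z′
          (Equivariant.cong k (InternalMap.cong f (λ a → p (γ a))))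
          (q (InternalMap.to f (to g′ ∘′ γ)))
    ; F-id   = λ {(Y , Z)} _ _ → RenamingSet.refl Z
    ; F-∘    = λ {_} {_} {(Y , Z)} _ _ → RenamingSet.refl Z
    }

  Inhabited : RenamingSet → Set u
  Inhabited X = ∣ X ∣

  -- Closedness cannot be asked for at the empty renaming set: 1 ◇ ∅ has an
  -- element (take n = 0 in the coend) while ∅^𝔸 is empty, so that
  -- Ren(1 ◇ ∅ , ∅) is empty but Ren(1 , [ ∅ , ∅ ]) is not.

  trivial : (S : Set u) → RenamingSet
  trivial S = record
    { setoid = ≡.setoid S
    ; _·_    = λ _ s → s
    ; ·-cong = λ _ p → p
    ; ·-id   = λ _ → ≡.refl
    ; ·-∘    = λ _ _ _ → ≡.refl
    ; finitely-supported = λ _ → [] , λ _ _ → ≡.refl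
    }

  not-closed-at-∅ : 𝔸 → ¬ RightClosedAt Ren ◇-functor hom-functor (λ _ → ⊤ {u})
  not-closed-at-∅ a closed = ⊥-elim (to h (0 , φ , λ ()))
    where
    𝟏 𝟎 : RenamingSet
    𝟏 = trivial ⊤
    𝟎 = trivial ⊥

    φ : Equivariant (Names ^ 0) 𝟏
    φ = record { func = record { to = λ _ → tt ; cong = λ _ → ≡.refl } ; equivariant = λ _ _ → ≡.refl }

    k : Equivariant 𝟏 [ 𝟎 , 𝟎 ]◇
    k = record
      { func = record
        { to   = λ _ → record
          { fun             = record { to = λ γ → γ a ; cong = λ p → p a }
          ; fun-equivariant = λ _ _ → ≡.refl
          ; reducible       = a ∷ [] , record { to = λ δ → Func.to δ (a , here ≡.refl) ; cong = λ p → p (a , here ≡.refl) }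
                        , λ _ → ≡.refl
          }
        ; cong = λ _ _ → ≡.refl
        }
      ; equivariant = λ _ _ _ → ≡.refl
      }

    h : Equivariant (𝟏 ◇ 𝟎) 𝟎
    h = proj₁ (proj₂ (RightClosedAt.Λ-bijective closed 𝟏 𝟎 𝟎 tt) k)

{-# OPTIONS --safe #-}
module Submission where

-- Two terms (φ , γ) and (φ′ , γ′) of X ◇ Y are equal exactly when they name the same element of X
-- under the same partial valuation of names: φ b ≈ φ′ b′ for some tuples of names b and b′ such
-- that equal names are given equal values by γ and γ′.  For transitivity, names are merged by
-- renamings.  This criterion replaces least supports throughout.
--
-- The associator is constructed from its inverse, which flattens x[yᵢ[ζᵢ]] to (x[yᵢ])[ζ] with ζ
-- the concatenation of the ζᵢ.  It is injective by the criterion; it is surjective because a term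
-- supported by the first n names can be written with all values supported by them.  Pentagon
-- and naturality transfer from the inverse.
--
-- Currying sends h to x ↦ (γ ↦ h (x[γ])).  For its inverse, a tuple in Y is extended to
-- a valuation of all names by a default element, which is immaterial since κ x depends only on
-- the names supporting x.

open import Data.Fin.Base using (Fin; zero; suc; toℕ; fromℕ<; splitAt; join; _↑ˡ_; _↑ʳ_)
open import Data.Fin.Properties
  using (any?; splitAt-join; splitAt-↑ˡ; splitAt-↑ʳ; toℕ-fromℕ<; toℕ-injective; toℕ<n)
open import Data.List.Base using (List; _++_; map; tabulate)
open import Data.List.Extrema.Nat using (max; xs≤max)
open import Data.List.Membership.Propositional using (_∈_; _∉_)
open import Data.List.Membership.Propositional.Properties
  using (∈-map⁺; ∈-++⁺ˡ; ∈-++⁺ʳ; ∈-tabulate⁺)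
open import Data.List.Relation.Unary.All using (lookup)
open import Data.Nat.Base using (ℕ; zero; suc; _+_; _⊔_; _≤_; _<_; s≤s)
open import Data.Nat.Properties
  using (_<?_; <⇒≱; <⇒≢; ≮⇒≥; ≤-reflexive; ≤-trans; <-≤-trans; n<1+n; m≤m+n; m≤m⊔n; m≤n⊔m; +-cancelˡ-≡)
  renaming (_≟_ to _≟ℕ_)
open import Data.Product.Base using (Σ; ∃; _×_; _,_; proj₁; proj₂)
open import Data.Sum.Base using (_⊎_; inj₁; inj₂; [_,_]′)
open import Function.Base using (_∘′_)
open import Function.Bundles using (_↔_; Func; Inverse)
open import Function.Definitions using (Bijective)
open import Level using (Level)
open import Relation.Binary.PropositionalEquality
  using (_≡_; _≢_; refl; sym; trans; cong; subst)
import Relation.Binary.Construct.Closure.Equivalence as EqC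
import Relation.Binary.Construct.Closure.ReflexiveTransitive as Star
import Relation.Binary.Construct.Closure.Symmetric as Sym
import Relation.Binary.Reasoning.Setoid as SetoidReasoning
open import Relation.Nullary.Decidable using (Dec; yes; no; recompute; recompute-constant; map′)
open import Relation.Nullary.Negation using (¬_; contradiction)
open import Defs

-- Renamings built from finite data, for names coded by natural numbers.

module NameSupply {u : Level} {𝔸 : Set u} (𝔸↔ℕ : 𝔸 ↔ ℕ) where
  open Renamings 𝔸

  open Inverse 𝔸↔ℕ public using ()
    renaming (to to code; from to name; strictlyInverseˡ to code-name; strictlyInverseʳ to name-code)

  code-injective : ∀ {a b} → code a ≡ code b → a ≡ b
  code-injective p = trans (sym (name-code _)) (trans (cong name p) (name-code _))

  name-injective : ∀ {m n} → name m ≡ name n → m ≡ n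
  name-injective p = trans (sym (code-name _)) (trans (cong code p) (code-name _))

  infix 4 _≟_
  _≟_ : (a b : 𝔸) → Dec (a ≡ b)
  a ≟ b = map′ code-injective (cong code) (code a ≟ℕ code b)

  initial : ∀ k → Fin k → 𝔸
  initial k i = name (toℕ i)

  initial-injective : ∀ {k} {i j : Fin k} → initial k i ≡ initial k j → i ≡ j
  initial-injective p = toℕ-injective (name-injective p)

  code-initial : ∀ {k} (i : Fin k) → code (initial k i) < k
  code-initial i = subst (_< _) (sym (code-name _)) (toℕ<n i)

  initial-fromℕ< : ∀ {k a} (a<k : code a < k) → initial k (fromℕ< a<k) ≡ a
  initial-fromℕ< a<k = trans (cong name (toℕ-fromℕ< a<k)) (name-code _)

  abstract
    list-bound : (A : List 𝔸) → ∃ λ k → ∀ {a} → a ∈ A → code a < k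
    list-bound A = suc (max 0 (map code A)) , λ a∈A → s≤s (lookup (xs≤max 0 (map code A)) (∈-map⁺ code a∈A))

  tuple-bound : ∀ {n} (w : Fin n → 𝔸) → ∃ λ k → ∀ i → code (w i) < k
  tuple-bound w = let (k , below-k) = list-bound (tabulate w) in k , λ i → below-k (∈-tabulate⁺ i)

  truncate : ℕ → (𝔸 → 𝔸) → Renaming
  truncate k f = record { fun = fun ; finite = tabulate (initial k) , fixed }
    where
    fun : 𝔸 → 𝔸
    fun a with code a <? k
    ... | yes _ = f a
    ... | no  _ = a

    fixed : ∀ a → a ∉ tabulate (initial k) → fun a ≡ a
    fixed a a∉ with code a <? k
    ... | yes a<k = contradiction (subst (_∈ _) (initial-fromℕ< a<k) (∈-tabulate⁺ (fromℕ< a<k))) a∉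
    ... | no  _   = refl

  truncate-< : ∀ {k} f {a} → code a < k → ⟦ truncate k f ⟧ a ≡ f a
  truncate-< {k} f {a} a<k with code a <? k
  ... | yes _   = refl
  ... | no  a≮k = contradiction a<k a≮k

  truncate-≥ : ∀ {k} f {a} → k ≤ code a → ⟦ truncate k f ⟧ a ≡ a
  truncate-≥ {k} f {a} k≤a with code a <? k
  ... | yes a<k = contradiction k≤a (<⇒≱ a<k)
  ... | no  _   = refl

  locate? : ∀ {n} (w : Fin n → 𝔸) a → Dec (∃ λ i → w i ≡ a)
  locate? w a = any? λ i → w i ≟ a

  module _ {n} (w : Fin n → 𝔸) (d : Fin n → 𝔸) where

    extend : Renaming
    extend = record { fun = fun ; finite = tabulate w , fixed }
      where
      fun : 𝔸 → 𝔸
      fun a with locate? w a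
      ... | yes (i , _) = d i
      ... | no  _       = a

      fixed : ∀ a → a ∉ tabulate w → fun a ≡ a
      fixed a a∉ with locate? w a
      ... | yes (i , refl) = contradiction (∈-tabulate⁺ i) a∉
      ... | no  _          = refl

    -- The tuple `w` may repeat a name, and the search may then return an index other than `i`; the
    -- hypothesis makes the choice harmless.
    extend-∘ : (∀ i j → w i ≡ w j → d i ≡ d j) → ∀ i → ⟦ extend ⟧ (w i) ≡ d i
    extend-∘ w⇒d i with locate? w (w i)
    ... | yes (j , wj≡wi) = w⇒d j i wj≡wi
    ... | no  ∄           = contradiction (i , refl) ∄

  module _ {m n} (w d : Fin m ⊎ Fin n → 𝔸) where

    -- Pairs of tuples are indexed by a disjoint union, which `splitAt` carries over to a single
    -- `Fin`.
    extend⊎ : Renaming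
    extend⊎ = extend (w ∘′ splitAt m) (d ∘′ splitAt m)

    extend⊎-∘ : (∀ p q → w p ≡ w q → d p ≡ d q) → ∀ p → ⟦ extend⊎ ⟧ (w p) ≡ d p
    extend⊎-∘ w⇒d p = subst (λ q → ⟦ extend⊎ ⟧ (w q) ≡ d q) (splitAt-join m n p)
      (extend-∘ _ _ (λ i j → w⇒d (splitAt m i) (splitAt m j)) (join m n p))

  assign : ∀ {k} → (Fin k → 𝔸) → Renaming
  assign b = extend (initial _) b

  -- No condition on `b` arises, since the names in `initial k` are distinct. Hence every tuple of
  -- `k` names is a renaming of `initial k`.
  assign-initial : ∀ {k} (b : Fin k → 𝔸) i → ⟦ assign b ⟧ (initial k i) ≡ b i
  assign-initial b = extend-∘ _ b λ i j p → cong b (initial-injective p)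

  replace : 𝔸 → 𝔸 → Renaming
  replace q p = extend {1} (λ _ → q) (λ _ → p)

  replace-cases : ∀ q p a → (a ≡ q × ⟦ replace q p ⟧ a ≡ p) ⊎ (⟦ replace q p ⟧ a ≡ a)
  replace-cases q p a with a ≟ q
  ... | yes refl = inj₁ (refl , extend-∘ {1} (λ _ → q) (λ _ → p) (λ _ _ _ → refl) zero)
  ... | no  a≢q  with locate? {1} (λ _ → q) a
  ...   | yes (_ , q≡a) = contradiction (sym q≡a) a≢q
  ...   | no  _         = inj₂ refl

  replace-target : ∀ q p → ⟦ replace q p ⟧ p ≡ p
  replace-target q p with replace-cases q p p
  ... | inj₁ (_ , e) = e
  ... | inj₂ e       = e

  replace-source : ∀ q p → ⟦ replace q p ⟧ q ≡ p
  replace-source q p = extend-∘ {1} (λ _ → q) (λ _ → p) (λ _ _ _ → refl) zero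

  -- For `merge`: after one replacement, compatibility is in question only for the single pair of
  -- distinct names that become equal.
  replace-kernel : ∀ q p a b → ⟦ replace q p ⟧ a ≡ ⟦ replace q p ⟧ b →
                   a ≡ b ⊎ (a ≡ q × b ≡ p) ⊎ (a ≡ p × b ≡ q)
  replace-kernel q p a b e with replace-cases q p a | replace-cases q p b
  ... | inj₁ (refl , _)  | inj₁ (refl , _)  = inj₁ refl
  ... | inj₁ (refl , e₁) | inj₂ e₂          = inj₂ (inj₁ (refl , trans (sym e₂) (trans (sym e) e₁)))
  ... | inj₂ e₁          | inj₁ (refl , e₂) = inj₂ (inj₂ (trans (sym e₁) (trans e e₂) , refl))
  ... | inj₂ e₁          | inj₂ e₂          = inj₁ (trans (sym e₁) (trans e e₂))

  -- Renames the names k, …, N - 1 to the name N.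
  gather : ℕ → ℕ → Renaming
  gather k N = truncate N f
    where
    f : 𝔸 → 𝔸
    f a with code a <? k
    ... | yes _ = a
    ... | no  _ = name N

  gather-cases : ∀ k N a → ⟦ gather k N ⟧ a ≡ a × (code a < k ⊎ N ≤ code a)
                         ⊎ ⟦ gather k N ⟧ a ≡ name N × code a < N × k ≤ code a
  gather-cases k N a with code a <? N
  ... | no  a≮N = inj₁ (refl , inj₂ (≮⇒≥ a≮N))
  ... | yes a<N with code a <? k
  ...   | yes a<k = inj₁ (refl , inj₁ a<k)
  ...   | no  a≮k = inj₂ (refl , a<N , ≮⇒≥ a≮k)

  gather-fixes : ∀ k N {a} → code a < k → ⟦ gather k N ⟧ a ≡ a
  gather-fixes k N {a} a<k with gather-cases k N a
  ... | inj₁ (e , _)       = e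
  ... | inj₂ (_ , _ , k≤a) = contradiction k≤a (<⇒≱ a<k)

  -- Renames the names n, …, k - 1 to n + k, …, 2k - 1.
  spread : ℕ → ℕ → Renaming
  spread n k = truncate k f
    where
    f : 𝔸 → 𝔸
    f a with code a <? n
    ... | yes _ = a
    ... | no  _ = name (k + code a)

  spread-cases : ∀ n k a → ⟦ spread n k ⟧ a ≡ a × (code a < n ⊎ k ≤ code a)
                         ⊎ ⟦ spread n k ⟧ a ≡ name (k + code a) × n ≤ code a
  spread-cases n k a with code a <? k
  ... | no  a≮k = inj₁ (refl , inj₂ (≮⇒≥ a≮k))
  ... | yes a<k with code a <? n
  ...   | yes a<n = inj₁ (refl , inj₁ a<n)
  ...   | no  a≮n = inj₂ (refl , ≮⇒≥ a≮n)

  spread-fixes : ∀ n k {a} → code a < n → ⟦ spread n k ⟧ a ≡ a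
  spread-fixes n k {a} a<n with spread-cases n k a
  ... | inj₁ (e , _)   = e
  ... | inj₂ (_ , n≤a) = contradiction n≤a (<⇒≱ a<n)

module Tensor {u : Level} {𝔸 : Set u} (𝔸↔ℕ : 𝔸 ↔ ℕ) where
  open Renamings 𝔸
  open NameSupply 𝔸↔ℕ
  open Equivariant using (to; equivariant) renaming (cong to to-cong)
  open Category Ren using () renaming (id to idₑ; _∘_ to _∘ₑ_)

  -- Supports, and equivariant maps out of finite powers of the names.

  module Support (X : RenamingSet) where
    open RenamingSet X hiding (refl; sym; trans)
    open SetoidReasoning setoid

    action-cong : ∀ {σ τ x} → (∀ a → ⟦ σ ⟧ a ≡ ⟦ τ ⟧ a) → σ · x ≈ τ · x
    action-cong σ≗τ = ·-cong σ≗τ (RenamingSet.refl X)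

    -- Initial segments of the names serve as supports: some segment supports each element, and it
    -- need not be least.
    SupportedBelow : ℕ → Carrier → Set u
    SupportedBelow k x = ∀ σ → (∀ {a} → code a < k → ⟦ σ ⟧ a ≡ a) → σ · x ≈ x

    abstract
      supported : ∀ x → ∃ λ k → SupportedBelow k x
      supported x =
        let (A , A-supports) = finitely-supported x
            (k , A-below)    = list-bound A
        in k , λ σ σ-fix → A-supports σ (λ a∈A → σ-fix (A-below a∈A))

    -- Composing with a renaming that fixes the support and gathers every other name moved
    -- by σ or τ in one place makes σ and τ equal.
    agree : ∀ {k x} → SupportedBelow k x → ∀ σ τ → (∀ {a} → code a < k → ⟦ σ ⟧ a ≡ ⟦ τ ⟧ a) →
            σ · x ≈ τ · x
    agree {k} {x} x-below σ τ σ≗τ = begin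
      σ · x          ≈⟨ ·-cong (λ _ → refl) (x-below ε (gather-fixes k N)) ⟨
      σ · (ε · x)    ≈⟨ ·-∘ σ ε x ⟨
      (σ ∘ᵣ ε) · x   ≈⟨ action-cong σε≗τε ⟩
      (τ ∘ᵣ ε) · x   ≈⟨ ·-∘ τ ε x ⟩
      τ · (ε · x)    ≈⟨ ·-cong (λ _ → refl) (x-below ε (gather-fixes k N)) ⟩
      τ · x          ∎
      where
      A = proj₁ (Renaming.finite σ)
      B = proj₁ (Renaming.finite τ)
      N = proj₁ (list-bound (A ++ B))
      ε = gather k N

      beyond : ∀ {a} → N ≤ code a → a ∉ A ++ B
      beyond N≤a a∈ = <⇒≱ (proj₂ (list-bound (A ++ B)) a∈) N≤a

      agree-beyond : ∀ {a} → N ≤ code a → ⟦ σ ⟧ a ≡ ⟦ τ ⟧ a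
      agree-beyond {a} N≤a =
        trans (proj₂ (Renaming.finite σ) a (λ a∈ → beyond N≤a (∈-++⁺ˡ a∈)))
              (sym (proj₂ (Renaming.finite τ) a (λ a∈ → beyond N≤a (∈-++⁺ʳ A a∈))))

      σε≗τε : ∀ a → ⟦ σ ∘ᵣ ε ⟧ a ≡ ⟦ τ ∘ᵣ ε ⟧ a
      σε≗τε a with gather-cases k N a
      ... | inj₁ (e , inj₁ a<k) rewrite e = σ≗τ a<k
      ... | inj₁ (e , inj₂ N≤a) rewrite e = agree-beyond N≤a
      -- The name `name N` itself lies beyond everything that `σ` or `τ` moves, so both fix it.
      ... | inj₂ (e , _) rewrite e = agree-beyond (≤-reflexive (sym (code-name N)))

    agree-initial : ∀ {k x} → SupportedBelow k x → ∀ σ τ →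
                    (∀ i → ⟦ σ ⟧ (initial k i) ≡ ⟦ τ ⟧ (initial k i)) → σ · x ≈ τ · x
    agree-initial x-below σ τ σ≗τ = agree x-below σ τ λ a<k →
      subst (λ a → ⟦ σ ⟧ a ≡ ⟦ τ ⟧ a) (initial-fromℕ< a<k) (σ≗τ (fromℕ< a<k))

    abstract
      -- Ren(𝔸ᵏ, X) is the set of elements supported by the first k names.
      generic : ∀ {k x} → SupportedBelow k x → Equivariant (Names ^ k) X
      generic {k} {x} x-below = record
        { func        = record
          { to   = λ b → assign b · x
          ; cong = λ {b} {c} b≗c → agree-initial x-below (assign b) (assign c) λ i →
              trans (assign-initial b i) (trans (b≗c i) (sym (assign-initial c i)))
          }
        ; equivariant = λ σ b → begin
            assign (λ i → ⟦ σ ⟧ (b i)) · x  ≈⟨ agree-initial x-below _ (σ ∘ᵣ assign b) (λ i →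
              trans (assign-initial _ i) (sym (cong ⟦ σ ⟧ (assign-initial b i)))) ⟩
            (σ ∘ᵣ assign b) · x             ≈⟨ ·-∘ σ (assign b) x ⟩
            σ · assign b · x                ∎
        }

      generic-initial : ∀ {k x} (x-below : SupportedBelow k x) → to (generic x-below) (initial k) ≈ x
      generic-initial {k} {x} x-below = begin
        assign (initial k) · x  ≈⟨ agree-initial x-below (assign (initial k)) idᵣ (assign-initial _) ⟩
        idᵣ · x                 ≈⟨ ·-id x ⟩
        x                       ∎

    to-initial-below : ∀ {k} (φ : Equivariant (Names ^ k) X) → SupportedBelow k (to φ (initial k))
    to-initial-below {k} φ σ σ-fix = begin
      σ · to φ (initial k)              ≈⟨ equivariant φ σ (initial k) ⟨
      to φ (λ i → ⟦ σ ⟧ (initial k i))  ≈⟨ to-cong φ (λ i → σ-fix (code-initial i)) ⟩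
      to φ (initial k)                  ∎

    to-∘ : ∀ {n} (φ : Equivariant (Names ^ n) X) σ {b c} → (∀ i → ⟦ σ ⟧ (b i) ≡ c i) → to φ c ≈ σ · to φ b
    to-∘ φ σ {b} {c} σb≗c = begin
      to φ c                    ≈⟨ to-cong φ (λ i → sym (σb≗c i)) ⟩
      to φ (λ i → ⟦ σ ⟧ (b i))  ≈⟨ equivariant φ σ b ⟩
      σ · to φ b                ∎

    -- The tuple `initial k` generates the power: any `b` is its image under `assign b`, and
    -- equivariance carries the equality over.
    determined : ∀ {k} (φ χ : Equivariant (Names ^ k) X) → to φ (initial k) ≈ to χ (initial k) → φ ≈ₑ χ
    determined {k} φ χ p b = begin
      to φ b                       ≈⟨ to-∘ φ (assign b) (assign-initial b) ⟩
      assign b · to φ (initial k)  ≈⟨ ·-cong (λ _ → refl) p ⟩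
      assign b · to χ (initial k)  ≈⟨ to-∘ χ (assign b) (assign-initial b) ⟨
      to χ b                       ∎

    -- By the hypothesis some renaming takes `b` to `c` and fixes `b′`. It leaves `to χ b′` in
    -- place, hence also `to φ b`, which it carries to `to φ c`.
    redirect : ∀ {m n} (φ : Equivariant (Names ^ m) X) (χ : Equivariant (Names ^ n) X) {b b′} c →
               to φ b ≈ to χ b′ →
               (∀ p q → [ b , b′ ]′ p ≡ [ b , b′ ]′ q → [ c , b′ ]′ p ≡ [ c , b′ ]′ q) →
               to φ c ≈ to φ b
    redirect φ χ {b} {b′} c e b⇒c = begin
      to φ c       ≈⟨ to-∘ φ σ (λ i → extend⊎-∘ [ b , b′ ]′ [ c , b′ ]′ b⇒c (inj₁ i)) ⟩
      σ · to φ b   ≈⟨ ·-cong (λ _ → refl) e ⟩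
      σ · to χ b′  ≈⟨ to-∘ χ σ (λ i → extend⊎-∘ [ b , b′ ]′ [ c , b′ ]′ b⇒c (inj₂ i)) ⟨
      to χ b′      ≈⟨ e ⟨
      to φ b       ∎
      where σ = extend⊎ [ b , b′ ]′ [ c , b′ ]′

  -- Equality in the substitution tensor.

  module Equality (X Y : RenamingSet) where
    private module X = RenamingSet X
            module Y = RenamingSet Y
            module XY = RenamingSet (X ◇ Y)
    open Support X using (to-∘)

    infix 4 _≋_
    _≋_ : Term X Y → Term X Y → Set u
    _≋_ = XY._≈_

    glue⇒≋ : ∀ {s t} → _~_ X Y s t → s ≋ t
    glue⇒≋ p = Sym.fwd p Star.◅ Star.ε

    ≋-eq : ∀ {n} {φ φ′ : Equivariant (Names ^ n) X} {γ γ′ : ∣ Y ^ n ∣} →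
           φ ≈ₑ φ′ → (∀ i → γ i Y.≈ γ′ i) → (n , φ , γ) ≋ (n , φ′ , γ′)
    ≋-eq p q = glue⇒≋ (glue (λ i → i) p (λ i → Y.sym (q i)))

    -- The pairs of `w p` and `v p` form the graph of a partial function from names to `Y`.
    Compatible : {I : Set} → (I → 𝔸) → (I → ∣ Y ∣) → Set u
    Compatible w v = ∀ p q → w p ≡ w q → v p Y.≈ v q

    -- (φ , γ) and (φ′ , γ′) name the same x ∈ X under the same partial valuation of names.
    infix 4 _≃_
    data _≃_ : Term X Y → Term X Y → Set u where
      match : ∀ {m n} {φ : Equivariant (Names ^ m) X} {φ′ : Equivariant (Names ^ n) X}
              {γ : ∣ Y ^ m ∣} {γ′ : ∣ Y ^ n ∣} (b : Fin m → 𝔸) (b′ : Fin n → 𝔸) →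
              to φ b X.≈ to φ′ b′ → Compatible {Fin m ⊎ Fin n} [ b , b′ ]′ [ γ , γ′ ]′ →
              (m , φ , γ) ≃ (n , φ′ , γ′)

    glue⇒≃ : ∀ {s t} → _~_ X Y s t → s ≃ t
    glue⇒≃ (glue {m} {n} f {γ = γ} {γ′} φ′≈φf γ′≈γf) =
      -- The variables of the first term get distinct names, and those of the second reuse these
      -- names along `f`.
      match (initial n) (λ i → initial n (f i)) (φ′≈φf (initial n)) λ where
        (inj₁ i) (inj₁ j) p → Y.reflexive (cong γ (initial-injective p))
        (inj₁ i) (inj₂ j) p → Y.trans (Y.reflexive (cong γ (initial-injective p))) (Y.sym (γ′≈γf j))
        (inj₂ i) (inj₁ j) p → Y.trans (γ′≈γf i) (Y.reflexive (cong γ (initial-injective p)))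
        (inj₂ i) (inj₂ j) p → Y.trans (γ′≈γf i)
          (Y.trans (Y.reflexive (cong γ (initial-injective p))) (Y.sym (γ′≈γf j)))

    ≃-refl : ∀ {s} → s ≃ s
    ≃-refl = glue⇒≃ (glue (λ i → i) (λ _ → X.refl) (λ _ → Y.refl))

    ≃-sym : ∀ {s t} → s ≃ t → t ≃ s
    ≃-sym (match b b′ e c) = match b′ b (X.sym e) λ where
      (inj₁ i) (inj₁ j) → c (inj₂ i) (inj₂ j)
      (inj₁ i) (inj₂ j) → c (inj₂ i) (inj₁ j)
      (inj₂ i) (inj₁ j) → c (inj₁ i) (inj₂ j)
      (inj₂ i) (inj₂ j) → c (inj₁ i) (inj₁ j)

    -- The pairs are merged one at a time. Each replacement identifies only two names whose values
    -- agree, so the renamed tuple is again compatible; this is why `w` varies in the induction.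
    merge : ∀ {I : Set} {v : I → ∣ Y ∣} n {p q : Fin n → I} → (∀ i → v (p i) Y.≈ v (q i)) →
            ∀ {w} → Compatible w v →
            ∃ λ σ → Compatible (λ i → ⟦ σ ⟧ (w i)) v × (∀ i → ⟦ σ ⟧ (w (p i)) ≡ ⟦ σ ⟧ (w (q i)))
    merge zero vp≈vq c = idᵣ , c , λ ()
    merge (suc n) {p} {q} vp≈vq {w} c = σ ∘ᵣ τ , c″ , λ where
        zero    → cong ⟦ σ ⟧ (trans (replace-target (w (q zero)) _) (sym (replace-source (w (q zero)) _)))
        (suc i) → σ-merges i
      where
      τ = replace (w (q zero)) (w (p zero))

      c′ : Compatible (λ i → ⟦ τ ⟧ (w i)) _
      c′ i j e with replace-kernel _ _ (w i) (w j) e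
      ... | inj₁ wi≡wj            = c i j wi≡wj
      ... | inj₂ (inj₁ (ei , ej)) =
        Y.trans (c i (q zero) ei) (Y.trans (Y.sym (vp≈vq zero)) (c (p zero) j (sym ej)))
      ... | inj₂ (inj₂ (ei , ej)) =
        Y.trans (c i (p zero) ei) (Y.trans (vp≈vq zero) (c (q zero) j (sym ej)))

      merged = merge n {λ i → p (suc i)} {λ i → q (suc i)} (λ i → vp≈vq (suc i)) c′
      σ = proj₁ merged
      c″ = proj₁ (proj₂ merged)
      σ-merges = proj₂ (proj₂ merged)

    -- Move the second pair of tuples away from the first and merge the two names of each
    -- variable of the middle term.
    ≃-trans : ∀ {s t r} → s ≃ t → t ≃ r → s ≃ r
    ≃-trans {l , φ , γ} {m , φ′ , γ′} {n , φ″ , γ″} (match b b′ e c) (match d d′ e′ c′) = match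
      (λ i → ⟦ σ ⟧ (b i)) (λ i → ⟦ σ ⟧ (⟦ θ ⟧ (d′ i)))
      (begin
        to φ (λ i → ⟦ σ ⟧ (b i))             ≈⟨ to-∘ φ σ (λ _ → refl) ⟩
        σ X.· to φ b                         ≈⟨ X.·-cong (λ _ → refl) e ⟩
        σ X.· to φ′ b′                       ≈⟨ to-∘ φ′ σ σ-merges ⟨
        to φ′ (λ i → ⟦ σ ⟧ (⟦ θ ⟧ (d i)))    ≈⟨ to-∘ φ′ (σ ∘ᵣ θ) (λ _ → refl) ⟩
        (σ ∘ᵣ θ) X.· to φ′ d                 ≈⟨ X.·-cong (λ _ → refl) e′ ⟩
        (σ ∘ᵣ θ) X.· to φ″ d′                ≈⟨ to-∘ φ″ (σ ∘ᵣ θ) (λ _ → refl) ⟨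
        to φ″ (λ i → ⟦ σ ⟧ (⟦ θ ⟧ (d′ i)))   ∎)
      λ where
        (inj₁ i) (inj₁ j) → σ-compatible (inj₁ (inj₁ i)) (inj₁ (inj₁ j))
        (inj₁ i) (inj₂ j) → σ-compatible (inj₁ (inj₁ i)) (inj₂ (inj₂ j))
        (inj₂ i) (inj₁ j) → σ-compatible (inj₂ (inj₂ i)) (inj₁ (inj₁ j))
        (inj₂ i) (inj₂ j) → σ-compatible (inj₂ (inj₂ i)) (inj₂ (inj₂ j))
      where
      open SetoidReasoning X.setoid

      w₁ = [ b , b′ ]′
      w₂ = [ d , d′ ]′
      k₁ = tuple-bound (w₁ ∘′ splitAt l)
      k₂ = tuple-bound (w₂ ∘′ splitAt m)
      k = proj₁ k₁ ⊔ proj₁ k₂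
      -- With lower bound 0, every name of code below `k` is shifted by `k`, past all names in both
      -- pairs of tuples.
      θ = spread 0 k

      w₁-below : ∀ p → code (w₁ p) < k
      w₁-below p = <-≤-trans
        (subst (λ p → code (w₁ p) < proj₁ k₁) (splitAt-join l m p) (proj₂ k₁ (join l m p)))
        (m≤m⊔n (proj₁ k₁) (proj₁ k₂))

      w₂-below : ∀ p → code (w₂ p) < k
      w₂-below p = <-≤-trans
        (subst (λ p → code (w₂ p) < proj₁ k₂) (splitAt-join m n p) (proj₂ k₂ (join m n p)))
        (m≤n⊔m (proj₁ k₁) (proj₁ k₂))

      θ-below : ∀ p → ⟦ θ ⟧ (w₂ p) ≡ name (k + code (w₂ p))
      θ-below p with spread-cases 0 k (w₂ p)
      ... | inj₁ (_ , inj₂ k≤) = contradiction k≤ (<⇒≱ (w₂-below p))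
      ... | inj₂ (e , _)       = e

      disjoint : ∀ p q → w₁ p ≢ ⟦ θ ⟧ (w₂ q)
      disjoint p q e = <⇒≱ (w₁-below p)
        (subst (k ≤_) (sym (trans (cong code (trans e (θ-below q))) (code-name _))) (m≤m+n k _))

      w : (Fin l ⊎ Fin m) ⊎ (Fin m ⊎ Fin n) → 𝔸
      w = [ w₁ , (λ p → ⟦ θ ⟧ (w₂ p)) ]′

      v : (Fin l ⊎ Fin m) ⊎ (Fin m ⊎ Fin n) → ∣ Y ∣
      v = [ [ γ , γ′ ]′ , [ γ′ , γ″ ]′ ]′

      compatible : Compatible w v
      compatible (inj₁ p) (inj₁ q) = c p q
      compatible (inj₁ p) (inj₂ q) e = contradiction e (disjoint p q)
      compatible (inj₂ p) (inj₁ q) e = contradiction (sym e) (disjoint q p)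
      compatible (inj₂ p) (inj₂ q) e = c′ p q (code-injective
        (+-cancelˡ-≡ k _ _ (name-injective (trans (sym (θ-below p)) (trans e (θ-below q))))))

      merged = merge m {p = λ i → inj₁ (inj₂ i)} {q = λ i → inj₂ (inj₁ i)} (λ _ → Y.refl) {w} compatible
      σ = proj₁ merged
      σ-compatible = proj₁ (proj₂ merged)

      σ-merges : ∀ i → ⟦ σ ⟧ (b′ i) ≡ ⟦ σ ⟧ (⟦ θ ⟧ (d i))
      σ-merges = proj₂ (proj₂ merged)

    ≋⇒≃ : ∀ {s t} → s ≋ t → s ≃ t
    ≋⇒≃ = EqC.fold (record { refl = ≃-refl ; sym = ≃-sym ; trans = ≃-trans }) glue⇒≃

    -- The apex has the variables of both terms, and a variable is read at the representative of
    -- those with the same name. For each tuple `d` a renaming takes every name to the value of `d`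
    -- at its representative; applied to the common element of `X`, it shows that both legs have the
    -- same map into `X`.
    ≃⇒span : ∀ {s t} → s ≃ t → ∃ λ r → _~_ X Y r s × _~_ X Y r t
    ≃⇒span {m , φ , γ} {n , φ′ , γ′} (match b b′ e c) =
      (m + n , φ ∘ₑ ψ (λ i → rep (i ↑ˡ n)) , δ) ,
      glue (λ i → rep (i ↑ˡ n)) (λ _ → X.refl)
        (λ i → Y.trans (Y.reflexive (cong [ γ , γ′ ]′ (sym (splitAt-↑ˡ m i n)))) (δ-rep (i ↑ˡ n))) ,
      glue (λ i → rep (m ↑ʳ i))
        (λ d → begin
          to φ (λ i → d (rep (i ↑ˡ n)))   ≈⟨ to-∘ φ (σ d) (σ-left d) ⟩
          σ d X.· to φ b                  ≈⟨ X.·-cong (λ _ → refl) e ⟩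
          σ d X.· to φ′ b′                ≈⟨ to-∘ φ′ (σ d) (σ-right d) ⟨
          to φ′ (λ i → d (rep (m ↑ʳ i)))  ∎)
        (λ i → Y.trans (Y.reflexive (cong [ γ , γ′ ]′ (sym (splitAt-↑ʳ m n i)))) (δ-rep (m ↑ʳ i)))
      where
      open SetoidReasoning X.setoid

      w : Fin (m + n) → 𝔸
      w p = [ b , b′ ]′ (splitAt m p)

      δ : Fin (m + n) → ∣ Y ∣
      δ p = [ γ , γ′ ]′ (splitAt m p)

      -- A canonical representative of each class of the kernel of w.
      locate : ∀ p → ∃ λ q → w q ≡ w p
      locate p = recompute (locate? w (w p)) (p , refl)

      rep : Fin (m + n) → Fin (m + n)
      rep p = proj₁ (locate p)

      -- Since `recompute` forgets the index given as evidence, `rep p` depends on the name `w p`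
      -- alone.
      rep-cong : ∀ p q → w p ≡ w q → rep p ≡ rep q
      rep-cong p q e = lemma (w p) (w q) e (p , refl) (q , refl)
        where
        lemma : ∀ a a′ → a ≡ a′ → (s : ∃ λ q → w q ≡ a) (t : ∃ λ q → w q ≡ a′) →
                proj₁ (recompute (locate? w a) s) ≡ proj₁ (recompute (locate? w a′) t)
        lemma a _ refl s t = cong proj₁ (recompute-constant (locate? w a) s t)

      δ-rep : ∀ p → δ p Y.≈ δ (rep p)
      δ-rep p = c (splitAt m p) (splitAt m (rep p)) (sym (proj₂ (locate p)))

      σ : (Fin (m + n) → 𝔸) → Renaming
      σ d = extend w (d ∘′ rep)

      σ-∘ : ∀ d p → ⟦ σ d ⟧ (w p) ≡ d (rep p)
      σ-∘ d = extend-∘ w (d ∘′ rep) (λ p q e → cong d (rep-cong p q e))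

      σ-left : ∀ d i → ⟦ σ d ⟧ (b i) ≡ d (rep (i ↑ˡ n))
      σ-left d i = trans (cong (⟦ σ d ⟧ ∘′ [ b , b′ ]′) (sym (splitAt-↑ˡ m i n))) (σ-∘ d (i ↑ˡ n))

      σ-right : ∀ d i → ⟦ σ d ⟧ (b′ i) ≡ d (rep (m ↑ʳ i))
      σ-right d i = trans (cong (⟦ σ d ⟧ ∘′ [ b , b′ ]′) (sym (splitAt-↑ʳ m n i))) (σ-∘ d (m ↑ʳ i))

    -- Replaces a zigzag of unknown length by one span, the form in which equalities enter the
    -- construction of the associator.
    ≋⇒span : ∀ {s t} → s ≋ t → ∃ λ r → _~_ X Y r s × _~_ X Y r t
    ≋⇒span p = ≃⇒span (≋⇒≃ p)

    ≃⇒≋ : ∀ {s t} → s ≃ t → s ≋ t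
    ≃⇒≋ p = let (_ , r~s , r~t) = ≃⇒span p in XY.trans (XY.sym (glue⇒≋ r~s)) (glue⇒≋ r~t)

    -- Values taken from one valuation of all names are automatically compatible.
    valuation-≋ : ∀ {m n} {φ : Equivariant (Names ^ m) X} {φ′ : Equivariant (Names ^ n) X} {b b′} →
                  to φ b X.≈ to φ′ b′ → (γ : 𝔸 → ∣ Y ∣) → (m , φ , γ ∘′ b) ≋ (n , φ′ , γ ∘′ b′)
    valuation-≋ {b = b} {b′} e γ = ≃⇒≋ (match b b′ e λ where
      (inj₁ _) (inj₁ _) p → Y.reflexive (cong γ p)
      (inj₁ _) (inj₂ _) p → Y.reflexive (cong γ p)
      (inj₂ _) (inj₁ _) p → Y.reflexive (cong γ p)
      (inj₂ _) (inj₂ _) p → Y.reflexive (cong γ p))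

  -- Isomorphisms from bijections; the two unitors.

  bijective⇒≅ : ∀ {X Y} (f : Equivariant X Y) →
                (∀ {x y} → RenamingSet._≈_ Y (to f x) (to f y) → RenamingSet._≈_ X x y) →
                (∀ y → ∃ λ x → RenamingSet._≈_ Y (to f x) y) → _≅_ Ren X Y
  bijective⇒≅ {X} {Y} f injective surjective = record
    { to   = f
    ; from = record
      { func        = record
        { to   = g
        ; cong = λ {y} {z} y≈z → injective (Y.trans (f∘g y) (Y.trans y≈z (Y.sym (f∘g z))))
        }
      ; equivariant = λ σ y → injective (Y.trans (f∘g (σ Y.· y))
          (Y.trans (Y.·-cong (λ _ → refl) (Y.sym (f∘g y))) (Y.sym (equivariant f σ (g y)))))
      }
    ; isoˡ = λ x → injective (f∘g (to f x))
    ; isoʳ = f∘g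
    }
    where
    module Y = RenamingSet Y

    g : ∣ Y ∣ → ∣ X ∣
    g y = proj₁ (surjective y)

    f∘g : ∀ y → to f (g y) Y.≈ y
    f∘g y = proj₂ (surjective y)

  project : Equivariant (Names ^ 1) Names
  project = record { func = record { to = λ b → b zero ; cong = λ p → p zero } ; equivariant = λ _ _ → refl }

  -- A name supported by the first `n` names is one of them, for otherwise a renaming that fixes
  -- these could move it. The map is then determined by its value at `initial n`.
  projection : ∀ {n} (φ : Equivariant (Names ^ n) Names) → ∃ λ i → ∀ b → to φ b ≡ b i
  projection {n} φ with code (to φ (initial n)) <? n
  ... | yes a<n = fromℕ< a<n , determined φ (project ∘ₑ ψ λ _ → fromℕ< a<n) (sym (initial-fromℕ< a<n))
    where open Support Names
  ... | no  a≮n = contradiction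
    (name-injective (trans (sym (replace-source a a′)) (trans σa≡a (sym (name-code a)))))
    (λ e → <⇒≢ (n<1+n (code a)) (sym e))
    where
    open Support Names
    a = to φ (initial n)
    a′ = name (suc (code a))

    σa≡a : ⟦ replace a a′ ⟧ a ≡ a
    σa≡a = to-initial-below φ (replace a a′) λ {c} c<n → fixes c c<n
      where
      fixes : ∀ c → code c < n → ⟦ replace a a′ ⟧ c ≡ c
      fixes c c<n with replace-cases a a′ c
      ... | inj₁ (refl , _) = contradiction c<n a≮n
      ... | inj₂ e          = e

  -- By `η`, every term equals the one-variable term on its own evaluation, so evaluation is
  -- injective.
  leftUnitor : ∀ X → _≅_ Ren (Names ◇ X) X
  leftUnitor X = bijective⇒≅ λ⊗
    (λ {s} {t} p → N◇X.trans (N◇X.sym (η s)) (N◇X.trans (E.≋-eq (λ _ → refl) (λ _ → p)) (η t)))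
    (λ x → (1 , project , λ _ → x) , unique project (λ _ → x))
    where
    open RenamingSet X using (_≈_)
    module X = RenamingSet X
    module N◇X = RenamingSet (Names ◇ X)
    module E = Equality Names X

    eval : Term Names X → ∣ X ∣
    eval (_ , φ , γ) = γ (proj₁ (projection φ))

    index-unique : ∀ {n} {i j : Fin n} → (∀ (b : Fin n → 𝔸) → b i ≡ b j) → i ≡ j
    index-unique p = initial-injective (p (initial _))

    unique : (φ : Equivariant (Names ^ 1) Names) (γ : ∣ X ^ 1 ∣) → γ (proj₁ (projection φ)) ≈ γ zero
    unique φ γ with projection φ
    ... | zero , _ = X.refl

    eval-~ : ∀ {s t} → _~_ Names X s t → eval s ≈ eval t
    eval-~ (glue f {φ} {φ′} {γ} {γ′} φ′≈φf γ′≈γf) = X.trans (X.reflexive (cong γ (index-unique λ b →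
        trans (sym (proj₂ (projection φ′) b)) (trans (φ′≈φf b) (proj₂ (projection φ) (b ∘′ f))))))
      (X.sym (γ′≈γf _))

    λ⊗ : Equivariant (Names ◇ X) X
    λ⊗ = record
      { func        = record { to = eval ; cong = EqC.gfold X.isEquivalence eval eval-~ }
      ; equivariant = λ _ _ → X.refl
      }

    η : ∀ s → (1 , project , λ _ → eval s) E.≋ s
    η (n , φ , γ) = N◇X.sym (E.glue⇒≋ (glue (λ _ → proj₁ (projection φ)) (proj₂ (projection φ)) λ _ → X.refl))

  -- The substitution x[γ] for a valuation of all names. The bound on the support is arbitrary;
  -- `plug-≋` shows that any other presentation of `x` gives the same class.
  plug : ∀ {X Y} → ∣ X ∣ → (𝔸 → ∣ Y ∣) → Term X Y
  plug {X} x γ = let (k , x-below) = Support.supported X x in k , Support.generic X x-below , γ ∘′ initial k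

  module _ {X Y : RenamingSet} where
    private module X = RenamingSet X
    open Support X
    open Equality X Y

    plug-≋ : ∀ {n} (φ : Equivariant (Names ^ n) X) b {x} → x X.≈ to φ b →
             ∀ γ → plug {X} {Y} x γ ≋ (n , φ , γ ∘′ b)
    plug-≋ φ b {x} p γ = valuation-≋ (X.trans (generic-initial (proj₂ (supported x))) p) γ

  -- A tuple `b` of names is the identity valuation composed with `b`, so `valuation-≋` turns equal
  -- evaluations into equal terms.
  rightUnitor : ∀ X → _≅_ Ren (X ◇ Names) X
  rightUnitor X = bijective⇒≅ ρ⊗
    (λ p → E.valuation-≋ p (λ a → a))
    (λ x → plug {X} {Names} x (λ a → a) , generic-initial (proj₂ (supported x)))
    where
    module X = RenamingSet X
    module E = Equality X Names
    open Support X

    eval : Term X Names → ∣ X ∣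
    eval (_ , φ , b) = to φ b

    ρ⊗ : Equivariant (X ◇ Names) X
    ρ⊗ = record
      { func        = record
        { to   = eval
        ; cong = EqC.gfold X.isEquivalence eval λ where
            (glue f {φ} p q) → X.trans (p _) (to-cong φ λ i → sym (q i))
        }
      ; equivariant = λ σ (_ , φ , b) → equivariant φ σ b
      }

  -- Terms whose values have bounded support.

  module _ {X Y : RenamingSet} where
    private module X = RenamingSet X
            module Y = RenamingSet Y
            module XY = RenamingSet (X ◇ Y)
            module SX = Support X
            module SY = Support Y
    open Equality X Y

    -- The spread element involves only names below `n` or from `k` on, and `y` only names below
    -- `k`. Cutting `σ` off at `k` keeps its action on `y` and makes it fix the spread element.
    spread-supports : ∀ {n k y z} → SY.SupportedBelow k y → SY.SupportedBelow k z →
                      y Y.≈ spread n k Y.· z → SY.SupportedBelow n y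
    spread-supports {n} {k} {y} {z} y-below z-below y≈θz σ σ-fix = begin
      σ Y.· y                 ≈⟨ SY.agree y-below σ τ (λ a<k → sym (truncate-< ⟦ σ ⟧ a<k)) ⟩
      τ Y.· y                 ≈⟨ Y.·-cong (λ _ → refl) y≈θz ⟩
      τ Y.· spread n k Y.· z  ≈⟨ Y.·-∘ τ (spread n k) z ⟨
      (τ ∘ᵣ spread n k) Y.· z ≈⟨ SY.agree z-below (τ ∘ᵣ spread n k) (spread n k) τθ≗θ ⟩
      spread n k Y.· z        ≈⟨ y≈θz ⟨
      y                       ∎
      where
      open SetoidReasoning Y.setoid
      τ = truncate k ⟦ σ ⟧

      τθ≗θ : ∀ {a} → code a < k → ⟦ τ ∘ᵣ spread n k ⟧ a ≡ ⟦ spread n k ⟧ a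
      τθ≗θ {a} a<k with spread-cases n k a
      ... | inj₁ (e , inj₁ a<n) rewrite e = trans (truncate-< ⟦ σ ⟧ a<k) (σ-fix a<n)
      ... | inj₁ (e , inj₂ k≤a) = contradiction k≤a (<⇒≱ a<k)
      ... | inj₂ (e , _) rewrite e =
        truncate-≥ ⟦ σ ⟧ (≤-trans (m≤m+n k (code a)) (≤-reflexive (sym (code-name _))))

    Confined : ℕ → Term X Y → Set u
    Confined n t = Σ (Term X Y) λ (m , φ , γ) → (m , φ , γ) ≋ t × (∀ i → SY.SupportedBelow n (γ i))

    -- The term t = (φ , γ) equals (φ , θ · γ), where θ spreads the names beyond n away from the
    -- support of γ.  This gives x = φ b = φ b′; a value of γ at a name in both b and b′ is
    -- supported by the first n names.  If there is such a name then the names in b but not in b′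
    -- can be renamed to it, and otherwise x has empty support.
    confine : ∀ {n} t → Support.SupportedBelow (X ◇ Y) n t → Confined n t
    confine {n} (m , φ , γ) t-below =
      let (k , γ-below) = Support.supported (Y ^ m) γ
          θ             = spread n k
      in confine-≃ (λ i σ σ-fix → γ-below σ σ-fix i)
           (≋⇒≃ {m , φ , γ} {m , φ , λ i → θ Y.· γ i} (XY.sym (t-below θ (spread-fixes n k))))
      where
      confine-≃ : ∀ {k} → (∀ i → SY.SupportedBelow k (γ i)) →
                  (m , φ , γ) ≃ (m , φ , λ i → spread n k Y.· γ i) → Confined n (m , φ , γ)
      confine-≃ γ-below (match b b′ e c) with any? (λ i → locate? b′ (b i))
      ... | yes (i₀ , common) =
        (m , φ , γ ∘′ r) , ≃⇒≋ (match (b ∘′ r) b φbr≈φb λ where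
          (inj₁ i) (inj₁ j) → c (inj₁ (r i)) (inj₁ (r j))
          (inj₁ i) (inj₂ j) → c (inj₁ (r i)) (inj₁ j)
          (inj₂ i) (inj₁ j) → c (inj₁ i) (inj₁ (r j))
          (inj₂ i) (inj₂ j) → c (inj₁ i) (inj₁ j)) ,
        λ i → let (l , b′l≡bri) = proj₁ (proj₂ (choose i))
              in spread-supports (γ-below (r i)) (γ-below l) (c (inj₁ (r i)) (inj₂ l) (sym b′l≡bri))
        where
        choose : ∀ i → ∃ λ j → (∃ λ l → b′ l ≡ b j) × (j ≡ i ⊎ (j ≡ i₀ × ¬ ∃ λ l → b′ l ≡ b i))
        choose i with locate? b′ (b i)
        ... | yes p = i , p , inj₁ refl
        ... | no ¬p = i₀ , common , inj₂ (refl , ¬p)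

        r : Fin m → Fin m
        r i = proj₁ (choose i)

        r-cong : ∀ i j → b i ≡ b j → b (r i) ≡ b (r j)
        r-cong i j bi≡bj with choose i | choose j
        ... | _ , _       , inj₁ refl       | _ , _       , inj₁ refl       = bi≡bj
        ... | _ , (l , p) , inj₁ refl       | _ , _       , inj₂ (refl , ∄) =
          contradiction (l , trans p bi≡bj) ∄
        ... | _ , _       , inj₂ (refl , ∄) | _ , (l , p) , inj₁ refl       =
          contradiction (l , trans p (sym bi≡bj)) ∄
        ... | _ , _       , inj₂ (refl , _) | _ , _       , inj₂ (refl , _) = refl

        r-common : ∀ i l → b i ≡ b′ l → b (r i) ≡ b′ l
        r-common i l bi≡b′l with choose i
        ... | _ , _ , inj₁ refl    = bi≡b′l
        ... | _ , _ , inj₂ (_ , ∄) = contradiction (l , sym bi≡b′l) ∄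

        φbr≈φb : to φ (b ∘′ r) X.≈ to φ b
        φbr≈φb = SX.redirect φ φ (b ∘′ r) e λ where
          (inj₁ i) (inj₁ j)   → r-cong i j
          (inj₁ i) (inj₂ l)   → r-common i l
          (inj₂ l) (inj₁ i) p → sym (r-common i l (sym p))
          (inj₂ _) (inj₂ _) p → p
      ... | no ∄ =
        (0 , SX.generic x-below , λ ()) ,
        ≃⇒≋ (match (initial 0) b (SX.generic-initial x-below) λ where
          (inj₂ i) (inj₂ j) → c (inj₁ i) (inj₁ j)) ,
        λ ()
        where
        open SetoidReasoning X.setoid

        -- No name of `b` occurs in `b′`, so all of `b` can be renamed to `a` with `b′` fixed. As
        -- `a` is arbitrary, every renaming then fixes `to φ b`.
        φ-const : ∀ a → to φ (λ _ → a) X.≈ to φ b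
        φ-const a = SX.redirect φ φ (λ _ → a) e λ where
          (inj₁ _) (inj₁ _) _ → refl
          (inj₁ i) (inj₂ l) p → contradiction (i , l , sym p) ∄
          (inj₂ l) (inj₁ i) p → contradiction (i , l , p) ∄
          (inj₂ _) (inj₂ _) p → p

        x-below : SX.SupportedBelow 0 (to φ b)
        x-below σ _ = begin
          σ X.· to φ b                    ≈⟨ X.·-cong (λ _ → refl) (φ-const (name 0)) ⟨
          σ X.· to φ (λ _ → name 0)       ≈⟨ SX.to-∘ φ σ (λ _ → refl) ⟨
          to φ (λ _ → ⟦ σ ⟧ (name 0))     ≈⟨ φ-const _ ⟩
          to φ b                          ∎

  -- Flattening of nested terms and the associator.

  total : ∀ {m} → (Fin m → ℕ) → ℕ
  total {zero}  n = 0
  total {suc m} n = n zero + total (n ∘′ suc)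

  enc : ∀ {m} (n : Fin m → ℕ) i → Fin (n i) → Fin (total n)
  enc n zero    j = j ↑ˡ total (n ∘′ suc)
  enc n (suc i) j = n zero ↑ʳ enc (n ∘′ suc) i j

  dec : ∀ {m} (n : Fin m → ℕ) → Fin (total n) → Σ (Fin m) (Fin ∘′ n)
  dec {suc m} n p =
    [ (λ j → zero , j) , (λ q → let (i , j) = dec (n ∘′ suc) q in suc i , j) ]′ (splitAt (n zero) p)

  dec-enc : ∀ {m} (n : Fin m → ℕ) i j → dec n (enc n i j) ≡ (i , j)
  dec-enc n zero    j rewrite splitAt-↑ˡ (n zero) j (total (n ∘′ suc)) = refl
  dec-enc n (suc i) j rewrite splitAt-↑ʳ (n zero) (total (n ∘′ suc)) (enc (n ∘′ suc) i j)
                            | dec-enc (n ∘′ suc) i j = refl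

  layer : ∀ {X Y m k} → Equivariant (Names ^ m) X → (Fin m → Equivariant (Names ^ k) Y) →
          Equivariant (Names ^ k) (X ◇ Y)
  layer {X} {Y} {m} φ χ = record
    { func        = record
      { to   = λ b → m , φ , λ i → to (χ i) b
      ; cong = λ b≗c → ≋-eq (λ _ → X.refl) (λ i → to-cong (χ i) b≗c)
      }
    ; equivariant = λ σ b → ≋-eq (λ _ → X.refl) (λ i → equivariant (χ i) σ b)
    }
    where
    module X = RenamingSet X
    open Equality X Y

  -- Reads off the data of a gluing by projection, for families of gluings, where the constructor
  -- cannot be matched.
  ~-elim : ∀ {X Y} {s t : Term X Y} → _~_ X Y s t → ∃ λ (f : Fin (proj₁ t) → Fin (proj₁ s)) →
           proj₁ (proj₂ s) ≈ₑ proj₁ (proj₂ t) ∘ₑ ψ f ×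
           (∀ i → RenamingSet._≈_ Y (proj₂ (proj₂ t) i) (proj₂ (proj₂ s) (f i)))
  ~-elim (glue f p q) = f , p , q

  module Associator (X Y Z : RenamingSet) where
    private module X = RenamingSet X
            module Y = RenamingSet Y
            module Z = RenamingSet Z
            module XY = Equality X Y
            module YZ = Equality Y Z
            module L = Equality X (Y ◇ Z)
            module R = Equality (X ◇ Y) Z
            module X◇Y = RenamingSet (X ◇ Y)
            module L◇ = RenamingSet (X ◇ (Y ◇ Z))
            module R◇ = RenamingSet ((X ◇ Y) ◇ Z)

    arity : ∀ {m} → (Fin m → Term Y Z) → Fin m → ℕ
    arity η i = proj₁ (η i)

    head : ∀ {m} (η : Fin m → Term Y Z) → ∀ i → Equivariant (Names ^ arity η i) Y
    head η i = proj₁ (proj₂ (η i))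

    args : ∀ {m} (η : Fin m → Term Y Z) → ∀ i → Fin (arity η i) → ∣ Z ∣
    args η i = proj₂ (proj₂ (η i))

    spine : ∀ {m} (η : Fin m → Term Y Z) → Fin (total (arity η)) → ∣ Z ∣
    spine η p = let (i , q) = dec (arity η) p in args η i q

    -- The concatenated variables fall into blocks, and the `i`-th inner head reads its own block
    -- through `enc`.
    flatten : Term X (Y ◇ Z) → Term (X ◇ Y) Z
    flatten (m , φ , η) = total (arity η) , layer φ (λ i → head η i ∘ₑ ψ (enc (arity η) i)) , spine η

    -- The gluing maps of the inner terms combine blockwise into one map `F` on the concatenated
    -- variables.
    flatten-~ : ∀ {m} (φ : Equivariant (Names ^ m) X) {η η′ : Fin m → Term Y Z} →
                (∀ i → _~_ Y Z (η i) (η′ i)) → flatten (m , φ , η) R.≋ flatten (m , φ , η′)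
    flatten-~ φ {η} {η′} η~η′ = R.glue⇒≋ (glue F
      (λ b → XY.≋-eq (λ _ → X.refl) λ i → Y.trans (proj₁ (proj₂ (~-elim (η~η′ i))) _)
        (to-cong (head η′ i) λ q → cong b (sym (F-enc i q))))
      (λ p → let (i , q) = dec (arity η′) p in Z.trans (proj₂ (proj₂ (~-elim (η~η′ i))) q)
        (Z.reflexive (cong (λ (i , q) → args η i q) (sym (dec-enc (arity η) i (f i q)))))))
      where
      f : ∀ i → Fin (arity η′ i) → Fin (arity η i)
      f i = proj₁ (~-elim (η~η′ i))

      F : Fin (total (arity η′)) → Fin (total (arity η))
      F p = let (i , q) = dec (arity η′) p in enc (arity η) i (f i q)

      F-enc : ∀ i q → F (enc (arity η′) i q) ≡ enc (arity η) i (f i q)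
      F-enc i q = cong (λ (i , q) → enc (arity η) i (f i q)) (dec-enc (arity η′) i q)

    -- Here `F` takes the block of `i` identically to the block of `f i`.
    flatten-∘ : ∀ {m n} (f : Fin m → Fin n) {φ : Equivariant (Names ^ m) X} {φ′ : Equivariant (Names ^ n) X}
                (η : Fin n → Term Y Z) → φ′ ≈ₑ φ ∘ₑ ψ f → flatten (n , φ′ , η) R.≋ flatten (m , φ , η ∘′ f)
    flatten-∘ f {φ} {φ′} η φ′≈φf = R.glue⇒≋ (glue F
      (λ b → XY.glue⇒≋ (glue f φ′≈φf λ i →
        to-cong (head η (f i)) λ q → cong b (F-enc i q)))
      (λ p → let (i , q) = dec (arity (η ∘′ f)) p in
        Z.reflexive (cong (λ (i , q) → args η i q) (sym (dec-enc (arity η) (f i) q)))))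
      where
      F : Fin (total (arity (η ∘′ f))) → Fin (total (arity η))
      F p = let (i , q) = dec (arity (η ∘′ f)) p in enc (arity η) (f i) q

      F-enc : ∀ i q → F (enc (arity (η ∘′ f)) i q) ≡ enc (arity η) (f i) q
      F-enc i q = cong (λ (i , q) → enc (arity η) (f i) q) (dec-enc (arity (η ∘′ f)) i q)

    abstract
      flatten-cong : ∀ {s t} → s L.≋ t → flatten s R.≋ flatten t
      flatten-cong = EqC.gfold R◇.isEquivalence flatten λ where
        (glue f {φ} {φ′} {η} {η′} p q) →
          -- Zigzags may differ in length from one `i` to the next, but spans have a uniform shape,
          -- so `flatten-~` treats all `i` at once.
          let spans i = YZ.≋⇒span (q i) in
          R◇.trans (flatten-∘ f η p)
            (R◇.trans (R◇.sym (flatten-~ φ {η = λ i → proj₁ (spans i)} λ i → proj₂ (proj₂ (spans i))))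
                      (flatten-~ φ λ i → proj₁ (proj₂ (spans i))))

    α⁻¹ : Equivariant (X ◇ (Y ◇ Z)) ((X ◇ Y) ◇ Z)
    α⁻¹ = record
      { func        = record { to = flatten ; cong = flatten-cong }
      ; equivariant = λ _ _ → R◇.refl
      }

    -- For `flatten-injective`: all inner terms receive the same variables and values, so that only
    -- their heads remain to be compared.
    widen : ∀ {m k} {φ : Equivariant (Names ^ m) X} {η : Fin m → Term Y Z} {δ : Fin k → ∣ Z ∣}
            (f : Fin (total (arity η)) → Fin k) → (∀ p → spine η p Z.≈ δ (f p)) →
            (m , φ , λ i → k , head η i ∘ₑ ψ (λ q → f (enc (arity η) i q)) , δ) L.≋ (m , φ , η)
    widen {η = η} f p = L.≋-eq (λ _ → X.refl) λ i →
      YZ.glue⇒≋ (glue (λ q → f (enc (arity η) i q)) (λ _ → Y.refl) λ q →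
        Z.trans (Z.reflexive (cong (λ (i , q) → args η i q) (sym (dec-enc (arity η) i q))))
                (p (enc (arity η) i q)))

    abstract
      -- The apex of a span supplies a common tuple `δ` to which both sides are widened. At the
      -- generic names its two legs give an equality in `X ◇ Y`; the names matching it also match
      -- the outer terms, since heads that agree at `initial k` are equal.
      flatten-injective : ∀ {s t} → flatten s R.≋ flatten t → s L.≋ t
      flatten-injective {m , φ , η} {n , φ′ , η′} e =
        let ((k , Χ , δ) , r~s , r~t) = R.≋⇒span e
            (f , p , q)    = ~-elim r~s
            (f′ , p′ , q′) = ~-elim r~t
        in L◇.trans (L◇.sym (widen f q))
             (L◇.trans (L.≃⇒≋ (same-args f f′ δ
               (XY.≋⇒≃ (X◇Y.trans (X◇Y.sym (p (initial k))) (p′ (initial k))))))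
                       (widen f′ q′))
        where
        same-args : ∀ {k} (f : Fin (total (arity η)) → Fin k) (f′ : Fin (total (arity η′)) → Fin k) δ →
          (m , φ , λ i → to (head η i) λ q → initial k (f (enc (arity η) i q))) XY.≃
          (n , φ′ , λ i → to (head η′ i) λ q → initial k (f′ (enc (arity η′) i q))) →
          (m , φ , λ i → k , head η i ∘ₑ ψ (λ q → f (enc (arity η) i q)) , δ) L.≃
          (n , φ′ , λ i → k , head η′ i ∘ₑ ψ (λ q → f′ (enc (arity η′) i q)) , δ)
        same-args {k} f f′ δ (XY.match b b′ e c) = L.match b b′ e λ where
            (inj₁ i) (inj₁ j) p → same (c (inj₁ i) (inj₁ j) p)
            (inj₁ i) (inj₂ j) p → same (c (inj₁ i) (inj₂ j) p)
            (inj₂ i) (inj₁ j) p → same (c (inj₂ i) (inj₁ j) p)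
            (inj₂ i) (inj₂ j) p → same (c (inj₂ i) (inj₂ j) p)
          where
          same : {χ χ′ : Equivariant (Names ^ k) Y} → to χ (initial k) Y.≈ to χ′ (initial k) →
                 (k , χ , δ) YZ.≋ (k , χ′ , δ)
          same {χ} {χ′} p = YZ.≋-eq (Support.determined Y χ χ′ p) (λ _ → Z.refl)

    -- Each value supported by the first `n` names comes from a map `χ i` on `n` names, so every
    -- inner term can take the whole tuple `ζ`. Flattening yields `m` copies of `ζ`, which gluing
    -- along `f` identifies.
    flatten-confined : ∀ {n} (Φ : Equivariant (Names ^ n) (X ◇ Y)) ζ → Confined n (to Φ (initial n)) →
                       ∃ λ s → flatten s R.≋ (n , Φ , ζ)
    flatten-confined {n} Φ ζ ((m , φ , γ) , t≋Φ , γ-below) =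
      (m , φ , λ i → n , χ i , ζ) ,
      R◇.sym (R.glue⇒≋ (glue f
        (Support.determined (X ◇ Y) Φ (layer φ (λ i → χ i ∘ₑ ψ (enc c i)) ∘ₑ ψ f) Φ≋layer)
        (λ _ → Z.refl)))
      where
      open Support Y using (generic; generic-initial)

      c : Fin m → ℕ
      c _ = n

      f : Fin (total c) → Fin n
      f p = proj₂ (dec c p)

      χ : Fin m → Equivariant (Names ^ n) Y
      χ i = generic (γ-below i)

      Φ≋layer : to Φ (initial n) XY.≋ (m , φ , λ i → to (χ i) λ q → initial n (f (enc c i q)))
      Φ≋layer = X◇Y.trans (X◇Y.sym t≋Φ) (XY.≋-eq (λ _ → X.refl) λ i → Y.trans
        (Y.sym (generic-initial (γ-below i)))
        (to-cong (χ i) λ q → cong (λ p → initial n (proj₂ p)) (sym (dec-enc c i q))))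

    abstract
      flatten-surjective : ∀ t → ∃ λ s → flatten s R.≋ t
      flatten-surjective (n , Φ , ζ) =
        flatten-confined Φ ζ (confine (to Φ (initial n)) (Support.to-initial-below (X ◇ Y) Φ))

    flatten-≅ : _≅_ Ren (X ◇ (Y ◇ Z)) ((X ◇ Y) ◇ Z)
    flatten-≅ = bijective⇒≅ α⁻¹ flatten-injective flatten-surjective

    α : Equivariant ((X ◇ Y) ◇ Z) (X ◇ (Y ◇ Z))
    α = _≅_.from flatten-≅

    α⁻¹∘α : ∀ t → to α⁻¹ (to α t) R.≋ t
    α⁻¹∘α = _≅_.isoʳ flatten-≅

    α∘α⁻¹ : ∀ s → to α (to α⁻¹ s) L.≋ s
    α∘α⁻¹ = _≅_.isoˡ flatten-≅

    associator : _≅_ Ren ((X ◇ Y) ◇ Z) (X ◇ (Y ◇ Z))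
    associator = record { to = α ; from = α⁻¹ ; isoˡ = α⁻¹∘α ; isoʳ = α∘α⁻¹ }

  -- Naturality and the coherence laws.

  infixr 10 _⊗₁_
  _⊗₁_ : ∀ {X X′ Y Y′} → Equivariant X X′ → Equivariant Y Y′ → Equivariant (X ◇ Y) (X′ ◇ Y′)
  f ⊗₁ g = Functor.F₁ ◇-functor (f , g)

  open Associator using (α; α⁻¹; α⁻¹∘α; α∘α⁻¹; flatten)

  λ-natural : ∀ {X X′} (f : Equivariant X X′) →
              _≅_.to (leftUnitor X′) ∘ₑ (idₑ {Names} ⊗₁ f) ≈ₑ f ∘ₑ _≅_.to (leftUnitor X)
  λ-natural {_} {X′} f (n , φ , γ) = to-cong (_≅_.to (leftUnitor X′))
    {n , idₑ ∘ₑ φ , to f ∘′ γ} {n , φ , to f ∘′ γ}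
    (Equality.≋-eq Names X′ (λ _ → refl) (λ _ → RenamingSet.refl X′))

  α-natural : ∀ {X X′ Y Y′ Z Z′} (f : Equivariant X X′) (g : Equivariant Y Y′) (h : Equivariant Z Z′) →
              α X′ Y′ Z′ ∘ₑ ((f ⊗₁ g) ⊗₁ h) ≈ₑ (f ⊗₁ (g ⊗₁ h)) ∘ₑ α X Y Z
  α-natural {X} {X′} {Y} {Y′} {Z} {Z′} f g h t = begin
    to (α X′ Y′ Z′) (to ((f ⊗₁ g) ⊗₁ h) t)
      ≈⟨ to-cong (α X′ Y′ Z′) (to-cong ((f ⊗₁ g) ⊗₁ h) (α⁻¹∘α X Y Z t)) ⟨
    to (α X′ Y′ Z′) (to ((f ⊗₁ g) ⊗₁ h) (to (α⁻¹ X Y Z) s))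
      -- Flattening commutes with the three maps componentwise, as they leave arities and blocks
      -- unchanged.
      ≈⟨ to-cong (α X′ Y′ Z′) (E.≋-eq (λ _ → RenamingSet.refl (X′ ◇ Y′)) (λ _ → RenamingSet.refl Z′)) ⟩
    to (α X′ Y′ Z′) (to (α⁻¹ X′ Y′ Z′) (to (f ⊗₁ (g ⊗₁ h)) s))
      ≈⟨ α∘α⁻¹ X′ Y′ Z′ _ ⟩
    to (f ⊗₁ (g ⊗₁ h)) s
      ∎
    where
    open SetoidReasoning (RenamingSet.setoid (X′ ◇ (Y′ ◇ Z′)))
    module E = Equality (X′ ◇ Y′) Z′
    s = to (α X Y Z) t

  triangle : ∀ X Y → (idₑ {X} ⊗₁ _≅_.to (leftUnitor Y)) ∘ₑ α X Names Y ≈ₑ _≅_.to (rightUnitor X) ⊗₁ idₑ {Y}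
  triangle X Y t = begin
    to (idₑ {X} ⊗₁ _≅_.to (leftUnitor Y)) s
      ≈⟨ id⊗λ s ⟩
    to (_≅_.to (rightUnitor X) ⊗₁ idₑ {Y}) (to (α⁻¹ X Names Y) s)
      ≈⟨ to-cong (_≅_.to (rightUnitor X) ⊗₁ idₑ {Y}) (α⁻¹∘α X Names Y t) ⟩
    to (_≅_.to (rightUnitor X) ⊗₁ idₑ {Y}) t
      ∎
    where
    open SetoidReasoning (RenamingSet.setoid (X ◇ Y))
    module XY = RenamingSet (X ◇ Y)
    module A = Associator X Names Y
    s = to (α X Names Y) t

    id⊗λ : ∀ s → to (idₑ {X} ⊗₁ _≅_.to (leftUnitor Y)) s
                 XY.≈ to (_≅_.to (rightUnitor X) ⊗₁ idₑ {Y}) (to (α⁻¹ X Names Y) s)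
    id⊗λ (m , φ , η) = XY.sym (Equality.glue⇒≋ X Y (glue
      -- Each inner head is a projection and so selects one variable of its block; the gluing map
      -- picks out these variables.
      (λ i → enc (A.arity η) i (proj₁ (projection (A.head η i))))
      (λ b → to-cong φ λ i → proj₂ (projection (A.head η i)) _)
      (λ i → RenamingSet.reflexive Y (cong (λ (i , q) → A.args η i q)
        (sym (dec-enc (A.arity η) i (proj₁ (projection (A.head η i)))))))))

  -- Cancelling each map against its inverse turns the pentagon into a statement about flattening
  -- alone.
  square-of-inverses :
    ∀ {A B C D E} (f : Equivariant A B) (g : Equivariant B C) (h : Equivariant C E)
    (k : Equivariant A D) (l : Equivariant D E)
    (f⁻¹ : Equivariant B A) (g⁻¹ : Equivariant C B) (h⁻¹ : Equivariant E C)
    (k⁻¹ : Equivariant D A) (l⁻¹ : Equivariant E D) →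
    f ∘ₑ f⁻¹ ≈ₑ idₑ → g ∘ₑ g⁻¹ ≈ₑ idₑ → h ∘ₑ h⁻¹ ≈ₑ idₑ → k⁻¹ ∘ₑ k ≈ₑ idₑ → l⁻¹ ∘ₑ l ≈ₑ idₑ →
    f⁻¹ ∘ₑ g⁻¹ ∘ₑ h⁻¹ ≈ₑ k⁻¹ ∘ₑ l⁻¹ → h ∘ₑ (g ∘ₑ f) ≈ₑ l ∘ₑ k
  square-of-inverses {E = E} f g h k l f⁻¹ g⁻¹ h⁻¹ k⁻¹ l⁻¹ ff⁻¹ gg⁻¹ hh⁻¹ k⁻¹k l⁻¹l e x = begin
    to hgf x                                           ≈⟨ to-cong hgf (k⁻¹k x) ⟨
    to hgf (to k⁻¹ (to k x))                           ≈⟨ to-cong hgf (to-cong k⁻¹ (l⁻¹l (to k x))) ⟨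
    to hgf (to k⁻¹ (to l⁻¹ y))                         ≈⟨ to-cong hgf (e y) ⟨
    to h (to g (to f (to f⁻¹ (to g⁻¹ (to h⁻¹ y)))))    ≈⟨ to-cong h (to-cong g (ff⁻¹ _)) ⟩
    to h (to g (to g⁻¹ (to h⁻¹ y)))                    ≈⟨ to-cong h (gg⁻¹ _) ⟩
    to h (to h⁻¹ y)                                    ≈⟨ hh⁻¹ y ⟩
    y                                                  ∎
    where
    open SetoidReasoning (RenamingSet.setoid E)
    hgf = h ∘ₑ g ∘ₑ f
    y = to l (to k x)

  module _ (W X Y Z : RenamingSet) where
    private module W = RenamingSet W
            module X = RenamingSet X
            module Y = RenamingSet Y
            module Z = RenamingSet Z
            module WX = Equality W X
            module WX-Y = Equality (W ◇ X) Y
            module WX-Y-Z = Equality ((W ◇ X) ◇ Y) Z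
            module WXY-Z = Equality (W ◇ (X ◇ Y)) Z
            module W-XYZ = Equality W (X ◇ (Y ◇ Z))

    -- Both sides flatten the same threefold nesting and differ only in how the concatenation is
    -- bracketed; `F` is the reindexing between the two bracketings.
    pentagon⁻¹ : (α⁻¹ W X Y ⊗₁ idₑ {Z}) ∘ₑ α⁻¹ W (X ◇ Y) Z ∘ₑ (idₑ {W} ⊗₁ α⁻¹ X Y Z)
                 ≈ₑ α⁻¹ (W ◇ X) Y Z ∘ₑ α⁻¹ W X (Y ◇ Z)
    pentagon⁻¹ (n , φ , τ) = WX-Y-Z.glue⇒≋ (glue F
      (λ b → WX-Y.≋-eq (λ _ → WX.≋-eq (λ _ → W.refl) λ _ → X.refl) λ k →
        to-cong (B.head (A.spine τ) k) λ q → cong b (sym (F-enc k q)))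
      (λ p → let (k , q) = dec (B.arity (A.spine τ)) p in Z.reflexive (sym (spine-f k q))))
      where
      module A = Associator W X (Y ◇ Z)
      module B = Associator (W ◇ X) Y Z
      module C = Associator X Y Z
      module D = Associator W (X ◇ Y) Z

      τ′ : Fin n → Term (X ◇ Y) Z
      τ′ i = flatten X Y Z (τ i)

      f : ∀ k → Fin (B.arity (A.spine τ) k) → Fin (total (D.arity τ′))
      f k q = let (i , j) = dec (A.arity τ) k in
        enc (D.arity τ′) i (enc (C.arity (A.args τ i)) j q)

      spine-f : ∀ k q → D.spine τ′ (f k q) ≡ B.args (A.spine τ) k q
      spine-f k q = let (i , j) = dec (A.arity τ) k in trans
        (cong (λ (i , p) → C.spine (A.args τ i) p) (dec-enc (D.arity τ′) i (enc (C.arity (A.args τ i)) j q)))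
        (cong (λ (j , q) → C.args (A.args τ i) j q) (dec-enc (C.arity (A.args τ i)) j q))

      F : Fin (total (B.arity (A.spine τ))) → Fin (total (D.arity τ′))
      F p = let (k , q) = dec (B.arity (A.spine τ)) p in f k q

      F-enc : ∀ k q → F (enc (B.arity (A.spine τ)) k q) ≡ f k q
      F-enc k q = cong (λ (k , q) → f k q) (dec-enc (B.arity (A.spine τ)) k q)

    pentagon : (idₑ {W} ⊗₁ α X Y Z) ∘ₑ (α W (X ◇ Y) Z ∘ₑ (α W X Y ⊗₁ idₑ {Z}))
               ≈ₑ α W X (Y ◇ Z) ∘ₑ α (W ◇ X) Y Z
    pentagon = square-of-inverses
      (α W X Y ⊗₁ idₑ {Z}) (α W (X ◇ Y) Z) (idₑ {W} ⊗₁ α X Y Z) (α (W ◇ X) Y Z) (α W X (Y ◇ Z))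
      (α⁻¹ W X Y ⊗₁ idₑ {Z}) (α⁻¹ W (X ◇ Y) Z) (idₑ {W} ⊗₁ α⁻¹ X Y Z) (α⁻¹ (W ◇ X) Y Z) (α⁻¹ W X (Y ◇ Z))
      (λ (_ , Φ , _) → WXY-Z.≋-eq (λ b → α∘α⁻¹ W X Y (to Φ b)) (λ _ → Z.refl))
      (α∘α⁻¹ W (X ◇ Y) Z)
      (λ (_ , _ , τ) → W-XYZ.≋-eq (λ _ → W.refl) (λ i → α∘α⁻¹ X Y Z (τ i)))
      (α⁻¹∘α (W ◇ X) Y Z)
      (α⁻¹∘α W X (Y ◇ Z))
      pentagon⁻¹

  -- Currying and its inverse.

  module Closed (X Y Z : RenamingSet) where
    private module X = RenamingSet X
            module Y = RenamingSet Y
            module Z = RenamingSet Z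
            module XY = RenamingSet (X ◇ Y)
            module YZ = RenamingSet [ Y , Z ]◇
    open Support X using (supported; generic; generic-initial; to-∘; to-initial-below)
    open Equality X Y using (≋-eq)
    open InternalMap using () renaming (to to app)

    curry₀ : Equivariant (X ◇ Y) Z → Equivariant X [ Y , Z ]◇
    curry₀ h = record
      { func        = record
        { to   = λ x → record
          { fun             = record
            { to   = λ γ → to h (plug {X} {Y} x γ)
            ; cong = λ p → to-cong h (≋-eq (λ _ → X.refl) (λ i → p _))
            }
          ; fun-equivariant = λ σ γ → equivariant h σ (plug {X} {Y} x γ)
          ; reducible       =
              -- The term `plug x γ` reads `γ` only at the first `k` names.
              let (k , x-below) = supported x in
              tabulate (initial k) , record
                { to   = λ δ → to h (k , generic x-below , λ i → Func.to δ (initial k i , ∈-tabulate⁺ i))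
                ; cong = λ p → to-cong h (≋-eq (λ _ → X.refl) (λ i → p _))
                } , λ _ → Z.refl
          }
        ; cong = λ {x} {y} p γ → to-cong h (plug-≋ (generic (proj₂ (supported y))) (initial _)
            (X.trans p (X.sym (generic-initial (proj₂ (supported y))))) γ)
        }
      -- As `σ · x` is the value of `generic` at the renamed tuple, plugging `γ` into it amounts to
      -- plugging `γ ∘′ ⟦ σ ⟧` into `x`.
      ; equivariant = λ σ x γ → to-cong h
          (plug-≋ (generic (proj₂ (supported x))) (λ i → ⟦ σ ⟧ (initial _ i))
            (X.trans (X.·-cong (λ _ → refl) (X.sym (generic-initial (proj₂ (supported x)))))
                     (X.sym (to-∘ (generic (proj₂ (supported x))) σ (λ _ → refl)))) γ)
      }

    curry : Func (Category.Hom Ren (X ◇ Y) Z) (Category.Hom Ren X [ Y , Z ]◇)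
    curry = record { to = curry₀ ; cong = λ p x γ → p (plug {X} {Y} x γ) }

    module _ (y₀ : ∣ Y ∣) where

      fill : ∀ {k} → ∣ Y ^ k ∣ → 𝔸 → ∣ Y ∣
      fill {k} γ a with code a <? k
      ... | yes a<k = γ (fromℕ< a<k)
      ... | no  _   = y₀

      fill-≥ : ∀ {k} (γ : ∣ Y ^ k ∣) {a} → k ≤ code a → fill γ a ≡ y₀
      fill-≥ {k} γ {a} k≤a with code a <? k
      ... | yes a<k = contradiction k≤a (<⇒≱ a<k)
      ... | no  _   = refl

      fill-< : ∀ {k} (γ : 𝔸 → ∣ Y ∣) {a} → code a < k → fill (γ ∘′ initial k) a ≡ γ a
      fill-< {k} γ {a} a<k with code a <? k
      ... | yes a<k′ = cong γ (initial-fromℕ< a<k′)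
      ... | no  a≮k  = contradiction a<k a≮k

      fill-initial : ∀ {k} (γ : ∣ Y ^ k ∣) i → fill γ (initial k i) ≡ γ i
      fill-initial {k} γ i with code (initial k i) <? k
      ... | yes i<k = cong γ (initial-injective (initial-fromℕ< i<k))
      ... | no  i≮k = contradiction (code-initial i) i≮k

      fill-cong : ∀ {k} {γ δ : ∣ Y ^ k ∣} → (∀ i → γ i Y.≈ δ i) → ∀ a → fill γ a Y.≈ fill δ a
      fill-cong {k} p a with code a <? k
      ... | yes a<k = p (fromℕ< a<k)
      ... | no  _   = Y.refl

      -- f reads finitely many names, so we may put y₀ at all others; gathering the names beyond
      -- the support of f that f may read onto one of those then replaces their values by y₀.
      app-fill : ∀ {k} f → Support.SupportedBelow [ Y , Z ]◇ k f →
                 ∀ γ → app f γ Z.≈ app f (fill (γ ∘′ initial k))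
      app-fill {k} f f-below γ = begin
        app f γ                        ≈⟨ local (λ a<N → Y.reflexive (sym (fill-< γ a<N))) ⟩
        app f γ₁                       ≈⟨ f-below ε (gather-fixes k N) γ₁ ⟨
        app f (γ₁ ∘′ ⟦ ε ⟧)            ≈⟨ local gathered ⟩
        app f (fill (γ ∘′ initial k))  ∎
        where
        open SetoidReasoning Z.setoid
        A = proj₁ (InternalMap.reducible f)
        N = proj₁ (list-bound A)
        ε = gather k N
        γ₁ = fill (γ ∘′ initial N)

        local : ∀ {γ δ} → (∀ {a} → code a < N → γ a Y.≈ δ a) → app f γ Z.≈ app f δ
        local {γ} {δ} p =
          let (_ , g , f≈g) = InternalMap.reducible f in
          Z.trans (f≈g γ) (Z.trans (Func.cong g λ (a , a∈A) → p (proj₂ (list-bound A) a∈A)) (Z.sym (f≈g δ)))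

        gathered : ∀ {a} → code a < N → γ₁ (⟦ ε ⟧ a) Y.≈ fill (γ ∘′ initial k) a
        gathered {a} a<N with gather-cases k N a
        ... | inj₁ (e , inj₁ a<k) = Y.reflexive (trans (cong γ₁ e) (trans (fill-< γ a<N) (sym (fill-< γ a<k))))
        ... | inj₁ (e , inj₂ N≤a) = contradiction N≤a (<⇒≱ a<N)
        ... | inj₂ (e , _ , k≤a)  = Y.reflexive (trans (cong γ₁ e)
          (trans (fill-≥ (γ ∘′ initial N) (≤-reflexive (sym (code-name N)))) (sym (fill-≥ _ k≤a))))

      module _ (κ : Equivariant X [ Y , Z ]◇) where

        -- Equivariance of `κ` does not enlarge supports, so `app-fill` applies with the first `m`
        -- names.
        app-initial : ∀ {m} (φ : Equivariant (Names ^ m) X) {δ} {γ : ∣ Y ^ m ∣} →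
                      (∀ i → δ (initial m i) Y.≈ γ i) →
                      app (to κ (to φ (initial m))) δ Z.≈ app (to κ (to φ (initial m))) (fill γ)
        app-initial {m} φ {δ} p = Z.trans
          (app-fill (to κ x) κx-below δ)
          (InternalMap.cong (to κ x) (fill-cong p))
          where
          x = to φ (initial m)

          κx-below : Support.SupportedBelow [ Y , Z ]◇ m (to κ x)
          κx-below σ σ-fix = YZ.trans {i = σ YZ.· to κ x} {j = to κ (σ X.· x)} {k = to κ x}
            (YZ.sym {x = to κ (σ X.· x)} {y = σ YZ.· to κ x} (equivariant κ σ x))
            (to-cong κ (to-initial-below φ σ σ-fix))

        uncurry₀ : Term X Y → ∣ Z ∣
        uncurry₀ (m , φ , γ) = app (to κ (to φ (initial m))) (fill γ)

        -- The renaming `σ` realises `f` on names. Equivariance of `κ` moves it from the element to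
        -- the valuation, which then agrees with `γ′` on the first `m` names.
        uncurry₀-~ : ∀ {s t} → _~_ X Y s t → uncurry₀ s Z.≈ uncurry₀ t
        uncurry₀-~ (glue {m} {n} f {φ} {φ′} {γ} {γ′} φ′≈φf γ′≈γf) = begin
          app (to κ (to φ′ (initial n))) (fill γ)
            ≈⟨ to-cong κ (X.trans (φ′≈φf (initial n)) (to-∘ φ σ (assign-initial b))) (fill γ) ⟩
          app (to κ (σ X.· to φ (initial m))) (fill γ)
            ≈⟨ equivariant κ σ (to φ (initial m)) (fill γ) ⟩
          app (to κ (to φ (initial m))) (fill γ ∘′ ⟦ σ ⟧)
            ≈⟨ app-initial φ (λ i → Y.trans
                 (Y.reflexive (trans (cong (fill γ) (assign-initial b i)) (fill-initial γ (f i))))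
                 (Y.sym (γ′≈γf i))) ⟩
          app (to κ (to φ (initial m))) (fill γ′)
            ∎
          where
          open SetoidReasoning Z.setoid

          b : Fin m → 𝔸
          b i = initial n (f i)

          σ = assign b

        uncurry : Equivariant (X ◇ Y) Z
        uncurry = record
          { func        = record { to = uncurry₀ ; cong = EqC.gfold Z.isEquivalence uncurry₀ uncurry₀-~ }
          ; equivariant = λ σ (m , φ , γ) →
              Z.trans (Z.sym (app-initial φ λ i → Y.·-cong (λ _ → refl) (Y.reflexive (fill-initial γ i))))
                      (InternalMap.fun-equivariant (to κ (to φ (initial m))) σ (fill γ))
          }

        curry-uncurry : curry₀ uncurry ≈ₑ κ
        curry-uncurry x γ = Z.trans
          (Z.sym (app-initial (generic (proj₂ (supported x))) (λ _ → Y.refl)))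
          (to-cong κ (generic-initial (proj₂ (supported x))) γ)

      -- Every term equals some `plug x γ`, with the valuation supplied by `fill`, and `curry₀ h`
      -- records `h` on all of these.
      curry-injective : ∀ {h h′} → curry₀ h ≈ₑ curry₀ h′ → h ≈ₑ h′
      curry-injective {h} {h′} p (m , φ , γ) = Z.trans (to-cong h plugged)
        (Z.trans (p (to φ (initial m)) (fill γ)) (to-cong h′ (XY.sym plugged)))
        where
        plugged : (m , φ , γ) XY.≈ plug {X} {Y} (to φ (initial m)) (fill γ)
        plugged = XY.trans (≋-eq (λ _ → X.refl) (λ i → Y.reflexive (sym (fill-initial γ i))))
                           (XY.sym (plug-≋ φ (initial m) X.refl (fill γ)))

      curry-bijective : Bijective _≈ₑ_ _≈ₑ_ curry₀
      curry-bijective = (λ {h} {h′} → curry-injective {h} {h′}) , λ κ →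
        uncurry κ , λ {h} p x γ → Z.trans (p (plug {X} {Y} x γ)) (curry-uncurry κ x γ)

  -- The two sides present `to f x` differently, through a generic map into `X′` or into `X`;
  -- `plug-≋` identifies the resulting terms.
  curry-natural : ∀ {X X′ Y Y′ Z Z′} (f : Equivariant X′ X) (g : Equivariant Y′ Y) (k : Equivariant Z Z′)
                  (h : Equivariant (X ◇ Y) Z) →
                  Closed.curry₀ X′ Y′ Z′ (k ∘ₑ (h ∘ₑ (f ⊗₁ g)))
                  ≈ₑ Functor.F₁ hom-functor (g , k) ∘ₑ (Closed.curry₀ X Y Z h ∘ₑ f)
  curry-natural {X} {X′} {Y} f g k h x γ = to-cong k (to-cong h (RenamingSet.sym (X ◇ Y)
    (plug-≋ (f ∘ₑ generic x-below) (initial _)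
      (to-cong f (RenamingSet.sym X′ (generic-initial x-below))) (to g ∘′ γ))))
    where
    open Support X′
    x-below = proj₂ (supported x)

theorem6p23 : {u : Level} (𝔸 : Set u) → 𝔸 ↔ ℕ →
    MonoidalStructure (Renamings.Ren 𝔸) (Renamings.◇-functor 𝔸) (Renamings.Names 𝔸)
    × RightClosedAt (Renamings.Ren 𝔸) (Renamings.◇-functor 𝔸) (Renamings.hom-functor 𝔸)
    (Renamings.Inhabited 𝔸)
theorem6p23 𝔸 𝔸↔ℕ =
  record
    { associator = Associator.associator
    ; unitorˡ    = leftUnitor
    ; unitorʳ    = rightUnitor
    ; α-natural  = α-natural
    ; λ-natural  = λ-natural
    ; ρ-natural  = λ {_} {X′} _ _ → RenamingSet.refl X′
    ; triangle   = triangle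
    ; pentagon   = pentagon
    } ,
  record
    { curry       = Closed.curry
    ; Λ-natural   = curry-natural
    ; Λ-bijective = Closed.curry-bijective
    }
  where
  open Renamings 𝔸
  open Tensor 𝔸↔ℕ
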